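{- Let $q$ be an odd prime power, let $\mathcal{C}$ be an irreducible conic in $\mathrm{PG}(2,q)$, let $L$ be an external line of $\mathcal{C}$, and let $\mathcal{S}$ be the set of $(q+1)/2$ exterior points of $\mathcal{C}$ on $L$. If $q\equiv 3 \pmod 4$, then every point $Q$ such that $\mathcal{S}\cup\{Q\}$ is an exterior set of $\mathcal{C}$ lies on $L$. If $q\equiv 1\pmod 4$, there is a unique point $Q$ not on $L$ such that $\mathcal{S}\cup\{Q\}$ is an exterior set of $\mathcal{C}$.
   Context: For an irreducible conic $\mathcal{C}$ in $\mathrm{PG}(2,q)$, $q$ odd: a line is external if it contains no point of $\mathcal{C}$; a point not on $\mathcal{C}$ is exterior if it lies on a tangent line of $\mathcal{C}$. A set of points $\mathcal{E}$ is an exterior set of $\mathcal{C}$ if every line containing at least two points of $\mathcal{E}$ is an external line of $\mathcal{C}$. -}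

module Defs where

open import Level using (0ℓ)
open import Data.Nat using (ℕ; suc; _%_)
open import Data.Fin using (Fin)
open import Data.Product using (Σ; ∃; _×_; _,_)
open import Data.Sum using (_⊎_)
open import Data.Empty using (⊥)
open import Relation.Nullary using (¬_)
open import Relation.Binary.PropositionalEquality using (_≡_)
open import Relation.Binary.Definitions using (DecidableEquality)
open import Function.Bundles using (_↔_)
open import Algebra.Structures using (IsCommutativeRing)

-- A finite field GF(q), with q elements, equality being propositional.
-- (Every finite field has prime-power order, so "q is an odd prime
-- power" amounts to: F is a finite field with q elements, q odd.)

record FiniteField (q : ℕ) : Set₁ where
  infixl 7 _*_
  infixl 6 _+_
  field
    Carrier : Set
    _+_ _*_ : Carrier → Carrier → Carrier
    -_      : Carrier → Carrier
    0# 1#   : Carrier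
    isCommutativeRing : IsCommutativeRing _≡_ _+_ _*_ -_ 0# 1#
    _≟_     : DecidableEquality Carrier
    1≢0     : ¬ (1# ≡ 0#)
    inverse : ∀ x → ¬ (x ≡ 0#) → Σ Carrier (λ y → x * y ≡ 1#)
    enumeration : Carrier ↔ Fin q

module Geometry {q : ℕ} (F : FiniteField q) where
  open FiniteField F

  2# : Carrier
  2# = 1# + 1#

  record Vec3 : Set where
    constructor ⟨_,_,_⟩
    field x y z : Carrier
  open Vec3 public

  NonZero3 : Vec3 → Set
  NonZero3 v = ¬ (x v ≡ 0# × y v ≡ 0# × z v ≡ 0#)

  -- points and lines of PG(2,q): nonzero vectors (up to scalars)
  record Point : Set where
    constructor pt
    field
      coords  : Vec3
      nonzero : NonZero3 coords
  open Point public

  record Line : Set where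
    constructor ln
    field
      lcoords  : Vec3
      lnonzero : NonZero3 lcoords
  open Line public

  scale : Carrier → Vec3 → Vec3
  scale c ⟨ a , b , d ⟩ = ⟨ c * a , c * b , c * d ⟩

  _≈P_ : Point → Point → Set
  P ≈P Q = Σ Carrier λ c → ¬ (c ≡ 0#) × scale c (coords P) ≡ coords Q

  _∈L_ : Point → Line → Set
  P ∈L ℓ = let u = coords P ; v = lcoords ℓ in
           x v * x u + y v * y u + z v * z u ≡ 0#

  record Conic : Set where
    constructor conic
    field a b c d e f : Carrier
  open Conic public

  evalC : Conic → Vec3 → Carrier
  evalC C ⟨ X , Y , Z ⟩ =
    a C * X * X + b C * Y * Y + c C * Z * Z
    + d C * X * Y + e C * X * Z + f C * Y * Z

  _∈C_ : Point → Conic → Set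
  P ∈C C = evalC C (coords P) ≡ 0#

  -- determinant of the symmetric matrix of the form (times 2):
  -- | 2a d  e |
  -- | d  2b f |
  -- | e  f 2c |
  det3 : Carrier → Carrier → Carrier → Carrier → Carrier → Carrier
       → Carrier → Carrier → Carrier → Carrier
  det3 m11 m12 m13 m21 m22 m23 m31 m32 m33 =
      m11 * (m22 * m33 + - (m23 * m32))
    + - (m12 * (m21 * m33 + - (m23 * m31)))
    + m13 * (m21 * m32 + - (m22 * m31))

  -- irreducible (= non-degenerate) conic, q odd
  Irreducible : Conic → Set
  Irreducible C =
    ¬ (det3 (2# * a C) (d C) (e C)
            (d C) (2# * b C) (f C)
            (e C) (f C) (2# * c C) ≡ 0#)

  External : Conic → Line → Set
  External C ℓ = ∀ P → P ∈L ℓ → ¬ (P ∈C C)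

  Tangent : Conic → Line → Set
  Tangent C ℓ = Σ Point λ P → P ∈L ℓ × P ∈C C ×
                  (∀ Q → Q ∈L ℓ → Q ∈C C → Q ≈P P)

  ExteriorPoint : Conic → Point → Set
  ExteriorPoint C P = ¬ (P ∈C C) × Σ Line λ ℓ → Tangent C ℓ × P ∈L ℓ

  ExteriorSet : Conic → (Point → Set) → Set
  ExteriorSet C E = ∀ (ℓ : Line) P₁ P₂ → E P₁ → E P₂ → ¬ (P₁ ≈P P₂)
                    → P₁ ∈L ℓ → P₂ ∈L ℓ → External C ℓ

  ExtOn : Conic → Line → Point → Set
  ExtOn C L P = ExteriorPoint C P × P ∈L L

  _∪｛_｝ : (Point → Set) → Point → (Point → Set)
  (S ∪｛ Q ｝) P = S P ⊎ P ≈P Q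

{-# OPTIONS --safe #-}
module Submission where

-- Let B be the polar form of the conic, E the pole of L, and γ = B(E,E).  The restriction of B to L is anisotropic,
-- and E lies off L and is orthogonal to it.
--
-- Let Q = V + t E with V on L and t ≠ 0 be such that S ∪ {Q} is exterior.  Take an orthogonal basis e₁, e₂ of L
-- with V = m e₁ (m ∈ {0, 1}), and put α = B(e₁,e₁), β = B(e₂,e₂).  Every u = X e₁ + Y e₂ with B(u,u) = - γ α β is an
-- exterior point, and the line Qu is external precisely when its discriminant is a nonsquare, which says that
-- (m Y)² - (γ t)² is a nonzero square.  If V ≠ 0 this holds for all q + 1 points of the ellipse
-- α X² + β Y² = - γ α β, and (X , Y) ↦ Y ± √(Y² - γ² t²), with the sign depending on X, injects these q + 1
-- points into the field.  Hence V = 0, so Q = E, and -1 is a square, that is q ≡ 1 (mod 4).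
--
-- Conversely, if i² = -1, a point of the conic on the line joining E to a point of S would yield an isotropic
-- vector on L.

open import Defs
open import Algebra.Bundles using (CommutativeRing)
import Algebra.Solver.Ring as RingSolver
open import Algebra.Solver.Ring.AlmostCommutativeRing using (_-Raw-AlmostCommutative⟶_; fromCommutativeRing)
open import Data.Bool using (Bool; true; false; if_then_else_)
open import Data.Fin as Fin using (Fin; zero; suc)
import Data.Fin.Properties as Fin
open import Data.Integer as ℤ using (ℤ; -[1+_]) renaming (+_ to pos)
import Data.Integer.Properties as ℤ
open import Data.List using (List; []; _∷_; length; filter; map; allFin)
open import Data.List.Membership.Propositional using (_∈_; _∉_)
open import Data.List.Membership.Propositional.Properties using (∈-filter⁺; ∈-filter⁻; ∈-map⁺; ∈-allFin)
open import Data.List.Membership.Propositional.Properties.WithK using (unique∧set⇒bag)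
import Data.List.Membership.DecPropositional as DecMembership
open import Data.List.Properties using (filter-notAll; length-map; length-tabulate)
open import Data.List.Relation.Binary.BagAndSetEquality using (∼bag⇒↭)
open import Data.List.Relation.Binary.Permutation.Propositional.Properties using (↭-length)
open import Data.List.Relation.Unary.All using ([]; _∷_)
open import Data.List.Relation.Unary.AllPairs using ([]; _∷_)
open import Data.List.Relation.Unary.Any using (here; there)
open import Data.List.Relation.Unary.Unique.Propositional using (Unique)
open import Data.List.Relation.Unary.Unique.Propositional.Properties using (filter⁺; map⁺; allFin⁺)
open import Data.Maybe using (Maybe; just; nothing) renaming (map to mapᴹ)
open import Data.Maybe.Properties using (just-injective)
open import Data.Nat as ℕ using (ℕ; zero; suc; _%_)
open import Data.Nat.Divisibility using (_∣_; _∣0; ∣m∣n⇒∣m+n; ∣-refl; divides)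
open import Data.Nat.DivMod using ([m+kn]%n≡m%n)
import Data.Nat.Properties as ℕ
open import Data.Product using (Σ; ∃; ∃₂; _×_; _,_; proj₁; proj₂)
open import Data.Sum as Sum using (_⊎_; inj₁; inj₂; [_,_]′)
open import Function using (_∘_; id)
open import Function.Bundles using (Inverse; mk⇔)
open import Level using (0ℓ)
open import Relation.Binary.Definitions using (DecidableEquality; tri<; tri≈; tri>)
open import Relation.Binary.PropositionalEquality using (_≡_; refl; sym; trans; cong; cong₂; subst)
open import Relation.Nullary using (¬_; Dec; yes; no; ¬?; contradiction; does)
open import Relation.Nullary.Decidable using (map′; decidable-stable; dec-true; dec-false; _×-dec_)
open import Relation.Nullary.Decidable.Core using (dec⇒maybe)
open import Relation.Unary using (Pred; Decidable)

-- The constant - γ α β comes from tangency. For u = X e₁ + Y e₂ put u⊥ = - β Y e₁ + α X e₂. Then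
-- B(u,u⊥) = 0 and B(u⊥,u⊥) = α β B(u,u), so u⊥ + α β E is orthogonal to u, and it is isotropic
-- exactly when B(u,u) = - γ α β; it is then the contact point of a tangent through u. The
-- discriminant of the line Qu equals - α β ((m Y)² - (γ t)²). Since L is external, - α β is itself
-- a nonsquare, and the quotient of two nonsquares is a nonzero square. The obstacle is V ≠ 0: no
-- single point of the ellipse need contradict this, and only all of them together do. The ellipse
-- has no point at infinity, so F ∪ {∞} parametrises it, and it has one point more than the field
-- has elements; the argument lives on that surplus of one. For V = 0 the difference is - (γ t)²,
-- and one point of the ellipse is enough. Squareness of -1 is tied to q modulo 4 by cutting the
-- field into fibres of four elements, with one or three elements left over.

-- Polynomial identities with integer coefficients in a commutative ring.

module IntegerCoefficients {c ℓ} (R : CommutativeRing c ℓ) where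
  open CommutativeRing R renaming (refl to ≈-refl; sym to ≈-sym; trans to ≈-trans)
  open import Algebra.Properties.Ring ring
  open import Algebra.Properties.Semiring.Mult.TCOptimised semiring renaming (_×_ to _×′_)
  open import Relation.Binary.Reasoning.Setoid setoid

  -- With the optimised multiple, `1 ×′ 1#` reduces to `1#`, so `one` denotes `1#` by computation
  -- and solved identities fit their goals.
  ⟦_⟧ℤ : ℤ → Carrier
  ⟦ pos n ⟧ℤ      = n ×′ 1#
  ⟦ -[1+ n ] ⟧ℤ = - (suc n ×′ 1#)

  ⟦⊖⟧ : ∀ m n → ⟦ m ℤ.⊖ n ⟧ℤ ≈ m ×′ 1# - n ×′ 1#
  ⟦⊖⟧ m       zero    = ≈-sym (≈-trans (+-congˡ -0#≈0#) (+-identityʳ _))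
  ⟦⊖⟧ zero    (suc n) = ≈-sym (+-identityˡ _)
  ⟦⊖⟧ (suc m) (suc n) = begin
    ⟦ suc m ℤ.⊖ suc n ⟧ℤ                ≡⟨ cong ⟦_⟧ℤ (ℤ.[1+m]⊖[1+n]≡m⊖n m n) ⟩
    ⟦ m ℤ.⊖ n ⟧ℤ                        ≈⟨ ⟦⊖⟧ m n ⟩
    m ×′ 1# - n ×′ 1#                      ≈⟨ +-congʳ (+-identityˡ _) ⟨
    0# + m ×′ 1# - n ×′ 1#                 ≈⟨ +-congʳ (+-congʳ (-‿inverseʳ 1#)) ⟨
    1# - 1# + m ×′ 1# - n ×′ 1#            ≈⟨ +-congʳ (≈-trans (+-assoc _ _ _) (≈-trans (+-congˡ (+-comm _ _)) (≈-sym (+-assoc _ _ _)))) ⟩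
    1# + m ×′ 1# - 1# - n ×′ 1#            ≈⟨ +-assoc _ _ _ ⟩
    1# + m ×′ 1# + (- 1# - n ×′ 1#)        ≈⟨ +-congˡ (-‿+-comm _ _) ⟩
    1# + m ×′ 1# - (1# + n ×′ 1#)          ≈⟨ +-cong (1+× m 1#) (-‿cong (1+× n 1#)) ⟨
    suc m ×′ 1# - suc n ×′ 1#              ∎

  ⟦+⟧ : ∀ i j → ⟦ i ℤ.+ j ⟧ℤ ≈ ⟦ i ⟧ℤ + ⟦ j ⟧ℤ
  ⟦+⟧ (pos m)    (pos n)    = ×-homo-+ 1# m n
  ⟦+⟧ (pos m)    -[1+ n ] = ⟦⊖⟧ m (suc n)
  ⟦+⟧ -[1+ m ] (pos n)    = ≈-trans (⟦⊖⟧ n (suc m)) (+-comm _ _)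
  ⟦+⟧ -[1+ m ] -[1+ n ] = begin
    - (suc (suc (m ℕ.+ n)) ×′ 1#)     ≡⟨ cong (λ k → - (suc k ×′ 1#)) (ℕ.+-suc m n) ⟨
    - ((suc m ℕ.+ suc n) ×′ 1#)       ≈⟨ -‿cong (×-homo-+ 1# (suc m) (suc n)) ⟩
    - (suc m ×′ 1# + suc n ×′ 1#)      ≈⟨ -‿+-comm _ _ ⟨
    - (suc m ×′ 1#) + - (suc n ×′ 1#)  ∎

  ⟦-⟧ : ∀ i → ⟦ ℤ.- i ⟧ℤ ≈ - ⟦ i ⟧ℤ
  ⟦-⟧ (pos zero)  = ≈-sym -0#≈0#
  ⟦-⟧ (pos (suc n)) = ≈-refl
  ⟦-⟧ -[1+ n ]  = ≈-sym (-‿involutive _)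

  ⟦+*⟧ : ∀ m j → ⟦ pos m ℤ.* j ⟧ℤ ≈ m ×′ 1# * ⟦ j ⟧ℤ
  ⟦+*⟧ m (pos n) = begin
    ⟦ pos m ℤ.* pos n ⟧ℤ  ≡⟨ cong ⟦_⟧ℤ (ℤ.pos-* m n) ⟨
    (m ℕ.* n) ×′ 1#    ≈⟨ ×1-homo-* m n ⟩
    m ×′ 1# * n ×′ 1#   ∎
  ⟦+*⟧ m -[1+ n ] = begin
    ⟦ pos m ℤ.* ℤ.- pos (suc n) ⟧ℤ    ≡⟨ cong ⟦_⟧ℤ (ℤ.neg-distribʳ-* (pos m) (pos (suc n))) ⟨
    ⟦ ℤ.- (pos m ℤ.* pos (suc n)) ⟧ℤ  ≈⟨ ⟦-⟧ (pos m ℤ.* pos (suc n)) ⟩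
    - ⟦ pos m ℤ.* pos (suc n) ⟧ℤ      ≈⟨ -‿cong (⟦+*⟧ m (pos (suc n))) ⟩
    - (m ×′ 1# * suc n ×′ 1#)     ≈⟨ -‿distribʳ-* _ _ ⟩
    m ×′ 1# * - (suc n ×′ 1#)     ∎

  ⟦*⟧ : ∀ i j → ⟦ i ℤ.* j ⟧ℤ ≈ ⟦ i ⟧ℤ * ⟦ j ⟧ℤ
  ⟦*⟧ (pos m)    j = ⟦+*⟧ m j
  ⟦*⟧ -[1+ m ] j = begin
    ⟦ ℤ.- pos (suc m) ℤ.* j ⟧ℤ      ≡⟨ cong ⟦_⟧ℤ (ℤ.neg-distribˡ-* (pos (suc m)) j) ⟨
    ⟦ ℤ.- (pos (suc m) ℤ.* j) ⟧ℤ    ≈⟨ ⟦-⟧ (pos (suc m) ℤ.* j) ⟩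
    - ⟦ pos (suc m) ℤ.* j ⟧ℤ        ≈⟨ -‿cong (⟦+*⟧ (suc m) j) ⟩
    - (suc m ×′ 1# * ⟦ j ⟧ℤ)     ≈⟨ -‿distribˡ-* _ _ ⟩
    - (suc m ×′ 1#) * ⟦ j ⟧ℤ     ∎

  morphism : ℤ.+-*-rawRing -Raw-AlmostCommutative⟶ fromCommutativeRing R
  morphism = record
    { ⟦_⟧ = ⟦_⟧ℤ ; +-homo = ⟦+⟧ ; *-homo = ⟦*⟧ ; -‿homo = ⟦-⟧ ; 0-homo = ≈-refl ; 1-homo = ≈-refl }

  open RingSolver ℤ.+-*-rawRing (fromCommutativeRing R) morphism
    -- Distinct integers may agree in R, so the test only ever answers positively. The
    -- characteristic enters through explicit hypotheses such as `2≡0`.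
    (λ i j → mapᴹ (λ i≡j → reflexive (cong ⟦_⟧ℤ i≡j)) (dec⇒maybe (i ℤ.≟ j)))
    public using (solve; _:=_; _:+_; _:*_; _:-_; :-_; con; Polynomial)

  nil one two : ∀ {n} → Polynomial n
  nil = con (pos 0)
  one = con (pos 1)
  two = one :+ one

-- Counting with duplicate-free lists.

length-filter-split : ∀ {a p} {A : Set a} {P : Pred A p} (P? : Decidable P) xs →
  length xs ≡ length (filter P? xs) ℕ.+ length (filter (¬? ∘ P?) xs)
length-filter-split P? [] = refl
length-filter-split P? (x ∷ xs) with P? x
... | yes _ = cong suc (length-filter-split P? xs)
... | no  _ = trans (cong suc (length-filter-split P? xs)) (sym (ℕ.+-suc _ _))

unique-length : ∀ {a} {A : Set a} {xs ys : List A} → Unique xs → Unique ys →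
  (∀ {z} → z ∈ xs → z ∈ ys) → (∀ {z} → z ∈ ys → z ∈ xs) → length xs ≡ length ys
unique-length xs! ys! to from =
  ↭-length (∼bag⇒↭ (unique∧set⇒bag xs! ys! (mk⇔ to from)))

module _ {a b} {A : Set a} {B : Set b} (_≟_ : DecidableEquality B) (φ : A → B) (k : ℕ) where

  EquinumerousFibres : List A → Set _
  EquinumerousFibres xs = ∀ {x} → x ∈ xs → Σ (List A) λ ys →
    length ys ≡ k × Unique ys × (∀ {z} → z ∈ ys → z ∈ xs × φ z ≡ φ x)
    × (∀ {z} → z ∈ xs → φ z ≡ φ x → z ∈ ys)

  private
    -- The fibre of the head contributes k and is removed; every other fibre survives whole, since φ
    -- takes another value there. The bound n carries the recursion, as `rest` is not a structural
    -- sublist.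
    go : ∀ n xs → length xs ℕ.≤ n → Unique xs → EquinumerousFibres xs → k ∣ length xs
    go n [] _ xs! fib = k ∣0
    go (suc n) xs@(x ∷ xs′) xs≤n xs! fib = subst (k ∣_) (sym split) (∣m∣n⇒∣m+n (subst (k ∣_) (sym same) ∣-refl)
        (go n rest (ℕ.≤-pred (ℕ.≤-trans (filter-notAll (¬? ∘ P?) xs (here λ ¬p → ¬p refl)) xs≤n))
            (filter⁺ (¬? ∘ P?) xs!) restFib))
      where
      P? : Decidable (λ y → φ y ≡ φ x)
      P? y = φ y ≟ φ x
      rest : List A
      rest = filter (¬? ∘ P?) xs
      split : length xs ≡ length (filter P? xs) ℕ.+ length rest
      split = length-filter-split P? xs
      same : length (filter P? xs) ≡ k
      same with fib (here refl)
      ... | ys , len , ys! , to , from = trans (unique-length (filter⁺ P? xs!) ys!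
        (λ z∈ → let z∈xs , eq = ∈-filter⁻ P? z∈ in from z∈xs eq)
        (λ z∈ → let z∈xs , eq = to z∈ in ∈-filter⁺ P? z∈xs eq)) len
      restFib : EquinumerousFibres rest
      restFib y∈ with ∈-filter⁻ (¬? ∘ P?) y∈
      ... | y∈xs , φy≢ with fib y∈xs
      ... | ys , len , ys! , to , from = ys , len , ys!
        , (λ z∈ → let z∈xs , eq = to z∈ in ∈-filter⁺ (¬? ∘ P?) z∈xs (φy≢ ∘ trans (sym eq)) , eq)
        , (λ z∈ → from (proj₁ (∈-filter⁻ (¬? ∘ P?) z∈)))

  fibres-divide-length : ∀ {xs} → Unique xs → EquinumerousFibres xs → k ∣ length xs
  fibres-divide-length {xs} = go (length xs) xs ℕ.≤-refl

module _ {a} {A : Set a} (_≟_ : DecidableEquality A) where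
  open DecMembership _≟_ using (_∈?_)

  length-without : ∀ {xs ys} → Unique xs → Unique ys → (∀ z → z ∈ xs) →
    length xs ≡ length ys ℕ.+ length (filter (¬? ∘ (_∈? ys)) xs)
  length-without {xs} {ys} xs! ys! all = trans (length-filter-split (_∈? ys) xs)
    (cong (ℕ._+ length (filter (¬? ∘ (_∈? ys)) xs)) (unique-length (filter⁺ (_∈? ys) xs!) ys!
      (λ z∈ → proj₂ (∈-filter⁻ (_∈? ys) {xs = xs} z∈)) (λ z∈ → ∈-filter⁺ (_∈? ys) (all _) z∈)))

-- Arithmetic and counting in a finite field.

module FieldTheory {q : ℕ} (F : FiniteField q) where
  open FiniteField F

  commutativeRing : CommutativeRing 0ℓ 0ℓ
  commutativeRing = record { isCommutativeRing = isCommutativeRing }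

  open IntegerCoefficients commutativeRing public using (solve; _:=_; _:+_; _:*_; _:-_; :-_; nil; one; two; Polynomial)
  open CommutativeRing commutativeRing public
    using (zeroˡ; zeroʳ; *-comm; *-assoc; *-identityˡ; +-identityˡ; +-identityʳ; -‿inverseʳ)

  diff≡0⇒≡ : ∀ {x y} → x + - y ≡ 0# → x ≡ y
  diff≡0⇒≡ {x} {y} h = trans (solve 2 (λ x y → x := (x :- y) :+ y) refl x y) (trans (cong (_+ y) h) (+-identityˡ y))

  ≡⇒diff≡0 : ∀ {x y} → x ≡ y → x + - y ≡ 0#
  ≡⇒diff≡0 refl = -‿inverseʳ _

  -- A certificate of ideal membership: x - y is written as a combination of the differences of
  -- known equations. The multipliers are given by hand, and the remaining identity goes to the ring
  -- solver.
  lincomb₁ : ∀ c {a b x y} → a ≡ b → x + - y ≡ c * (a + - b) → x ≡ y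
  lincomb₁ c a≡b h = diff≡0⇒≡ (trans h (trans (cong (c *_) (≡⇒diff≡0 a≡b)) (zeroʳ c)))

  lincomb₂ : ∀ c c′ {a b a′ b′ x y} → a ≡ b → a′ ≡ b′ → x + - y ≡ c * (a + - b) + c′ * (a′ + - b′) → x ≡ y
  lincomb₂ c c′ {a} {b} a≡b a′≡b′ h = lincomb₁ c a≡b (trans h
    (trans (cong (c * (a + - b) +_) (trans (cong (c′ *_) (≡⇒diff≡0 a′≡b′)) (zeroʳ c′))) (+-identityʳ _)))

  lincomb₃ : ∀ c c′ c″ {a b a′ b′ a″ b″ x y} → a ≡ b → a′ ≡ b′ → a″ ≡ b″ →
    x + - y ≡ c * (a + - b) + c′ * (a′ + - b′) + c″ * (a″ + - b″) → x ≡ y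
  lincomb₃ c c′ c″ {a} {b} {a′} {b′} a≡b a′≡b′ a″≡b″ h = lincomb₂ c c′ a≡b a′≡b′ (trans h
    (trans (cong (c * (a + - b) + c′ * (a′ + - b′) +_) (trans (cong (c″ *_) (≡⇒diff≡0 a″≡b″)) (zeroʳ c″))) (+-identityʳ _)))

  -- Total, with a dummy value at `0#`, so that quotients are plain terms and nonvanishing is asked
  -- for only when a quotient is cancelled.
  inv : Carrier → Carrier
  inv x with x ≟ 0#
  ... | yes _  = 0#
  ... | no x≢0 = proj₁ (inverse x x≢0)

  inv-inverseʳ : ∀ {x} → ¬ x ≡ 0# → x * inv x ≡ 1#
  inv-inverseʳ {x} x≢0 with x ≟ 0#
  ... | yes x≡0 = contradiction x≡0 x≢0
  ... | no x≢0′ = proj₂ (inverse x x≢0′)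

  x*y≡0⇒y≡0 : ∀ {x y} → ¬ x ≡ 0# → x * y ≡ 0# → y ≡ 0#
  x*y≡0⇒y≡0 {x} {y} x≢0 xy≡0 = lincomb₂ (- y) (inv x) (inv-inverseʳ x≢0) xy≡0
    (solve 3 (λ x y i → y :- nil := (:- y) :* (x :* i :- one) :+ i :* (x :* y :- nil)) refl x y (inv x))

  inv-nonzero : ∀ {x} → ¬ x ≡ 0# → ¬ inv x ≡ 0#
  inv-nonzero {x} x≢0 e = 1≢0 (trans (sym (inv-inverseʳ x≢0)) (trans (cong (x *_) e) (zeroʳ x)))

  x*y≡0⇒x≡0∨y≡0 : ∀ {x y} → x * y ≡ 0# → x ≡ 0# ⊎ y ≡ 0#
  x*y≡0⇒x≡0∨y≡0 {x} xy≡0 with x ≟ 0#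
  ... | yes x≡0 = inj₁ x≡0
  ... | no  x≢0 = inj₂ (x*y≡0⇒y≡0 x≢0 xy≡0)

  *-nonzero : ∀ {x y} → ¬ x ≡ 0# → ¬ y ≡ 0# → ¬ x * y ≡ 0#
  *-nonzero x≢0 y≢0 = y≢0 ∘ x*y≡0⇒y≡0 x≢0

  *-cancelˡ : ∀ {x y z} → ¬ x ≡ 0# → x * y ≡ x * z → y ≡ z
  *-cancelˡ {x} {y} {z} x≢0 h = diff≡0⇒≡ (x*y≡0⇒y≡0 x≢0
    (trans (solve 3 (λ x y z → x :* (y :- z) := x :* y :- x :* z) refl x y z) (≡⇒diff≡0 h)))

  -‿nonzero : ∀ {x} → ¬ x ≡ 0# → ¬ - x ≡ 0#
  -‿nonzero {x} x≢0 h = x≢0 (lincomb₁ (- 1#) h (solve 1 (λ x → x :- nil := (:- one) :* ((:- x) :- nil)) refl x))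

  squares-equal : ∀ {x y} → x * x ≡ y * y → x ≡ y ⊎ x ≡ - y
  squares-equal {x} {y} h = Sum.map diff≡0⇒≡ diff≡0⇒≡ (x*y≡0⇒x≡0∨y≡0
    (trans (solve 2 (λ x y → (x :- y) :* (x :- :- y) := x :* x :- y :* y) refl x y) (≡⇒diff≡0 h)))

  -‿involutive : ∀ x → - - x ≡ x
  -‿involutive = solve 1 (λ x → :- (:- x) := x) refl

  IsSquare : Carrier → Set
  IsSquare x = ∃ λ y → y * y ≡ x

  open Inverse enumeration using () renaming (to to index; from to element)

  element-index : ∀ x → element (index x) ≡ x
  element-index = Inverse.strictlyInverseʳ enumeration

  index-injective : ∀ {x y} → index x ≡ index y → x ≡ y
  index-injective {x} {y} e = trans (sym (element-index x)) (trans (cong element e) (element-index y))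

  element-injective : ∀ {i j} → element i ≡ element j → i ≡ j
  element-injective {i} {j} e = trans (sym (Inverse.strictlyInverseˡ enumeration i))
    (trans (cong index e) (Inverse.strictlyInverseˡ enumeration j))

  any? : ∀ {p} {P : Pred Carrier p} → Decidable P → Dec (∃ P)
  any? {P = P} P? = map′ (λ (i , p) → element i , p) (λ (x , p) → index x , subst P (sym (element-index x)) p)
    (Fin.any? (P? ∘ element))

  isSquare? : Decidable IsSquare
  isSquare? x = any? (λ y → (y * y) ≟ x)

  -- `Maybe Carrier` stands for F ∪ {∞}, which has q + 1 elements; this is the pigeonhole principle.
  no-injection : (f : Maybe Carrier → Carrier) → ¬ (∀ {x y} → f x ≡ f y → x ≡ y)
  no-injection f f-inj = ℕ.<-irrefl refl (Fin.injective⇒≤ {f = index ∘ f ∘ points} (points-inj ∘ f-inj ∘ index-injective))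
    where
    points : Fin (suc q) → Maybe Carrier
    points zero    = nothing
    points (suc i) = just (element i)
    points-inj : ∀ {i j} → points i ≡ points j → i ≡ j
    points-inj {zero}  {zero}  e = refl
    points-inj {suc i} {suc j} e = cong suc (element-injective (just-injective e))

  elements : List Carrier
  elements = map element (allFin q)

  elements-complete : ∀ x → x ∈ elements
  elements-complete x = subst (_∈ elements) (element-index x) (∈-map⁺ element (∈-allFin (index x)))

  elements-unique : Unique elements
  elements-unique = map⁺ element-injective (allFin⁺ q)

  length-elements : length elements ≡ q
  length-elements = trans (length-map element (allFin q)) (length-tabulate id)

  inv-unique : ∀ {x y} → x * y ≡ 1# → inv x ≡ y
  inv-unique {x} {y} xy≡1 = *-cancelˡ x≢0 (trans (inv-inverseʳ x≢0) (sym xy≡1))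
    where
    x≢0 : ¬ x ≡ 0#
    x≢0 refl = 1≢0 (trans (sym xy≡1) (zeroˡ y))

  open DecMembership _≟_ using (_∈?_)

  FibreOutside : ℕ → (Carrier → Carrier) → List Carrier → Carrier → Set
  FibreOutside k φ ys x = Σ (List Carrier) λ zs → length zs ≡ k × Unique zs
    × (∀ {z} → z ∈ zs → z ∉ ys × φ z ≡ φ x) × (∀ {z} → z ∉ ys → φ z ≡ φ x → z ∈ zs)

  -- Off the exceptional elements `ys` the field is a disjoint union of fibres of size k, so q =
  -- length ys + m k.
  order-mod : ∀ k .{{_ : ℕ.NonZero k}} (φ : Carrier → Carrier) ys → Unique ys →
    (∀ {x} → x ∉ ys → FibreOutside k φ ys x) → q ℕ.% k ≡ length ys ℕ.% k
  order-mod k φ ys ys! fib with fibres-divide-length _≟_ φ k (filter⁺ (¬? ∘ (_∈? ys)) elements-unique) fib′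
    where
    fib′ : EquinumerousFibres _≟_ φ k (filter (¬? ∘ (_∈? ys)) elements)
    fib′ x∈ with fib (proj₂ (∈-filter⁻ (¬? ∘ (_∈? ys)) {xs = elements} x∈))
    ... | zs , len , zs! , to , from = zs , len , zs!
      , (λ z∈ → ∈-filter⁺ (¬? ∘ (_∈? ys)) (elements-complete _) (proj₁ (to z∈)) , proj₂ (to z∈))
      , (λ z∈ → from (proj₂ (∈-filter⁻ (¬? ∘ (_∈? ys)) {xs = elements} z∈)))
  ... | divides m eq = trans (cong (ℕ._% k) (trans (sym length-elements)
          (trans (length-without _≟_ elements-unique ys! elements-complete) (cong (length ys ℕ.+_) eq))))
          ([m+kn]%n≡m%n (length ys) m k)

  -- In characteristic 2 the fibres of x ↦ x² + x are the pairs {x , x + 1}.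
  odd-order⇒2≢0 : q ℕ.% 2 ≡ 1 → ¬ 1# + 1# ≡ 0#
  odd-order⇒2≢0 odd 2≡0 = contradiction (trans (sym odd) (order-mod 2 (λ x → x * x + x) [] [] fib)) λ ()
    where
    fib : ∀ {x} → x ∉ [] → FibreOutside 2 (λ x → x * x + x) [] x
    fib {x} _ = x ∷ x + 1# ∷ [] , refl , ((x≢x+1 ∷ []) ∷ [] ∷ [])
      , (λ { (here refl) → (λ ()) , refl
           ; (there (here refl)) → (λ ()) , lincomb₁ (x + 1#) 2≡0
               (solve 1 (λ x → ((x :+ one) :* (x :+ one) :+ (x :+ one)) :- (x :* x :+ x)
                  := (x :+ one) :* (two :- nil)) refl x) })
      , λ {z} _ e → [ (λ h → here (diff≡0⇒≡ h))
          , (λ h → there (here (lincomb₂ 1# (- (x + 1#)) h 2≡0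
              (solve 2 (λ z x → z :- (x :+ one) := one :* ((z :+ x :+ one) :- nil) :+ (:- (x :+ one)) :* (two :- nil)) refl z x)))) ]′
          (x*y≡0⇒x≡0∨y≡0 (trans
              (solve 2 (λ z x → (z :- x) :* (z :+ x :+ one) := (z :* z :+ z) :- (x :* x :+ x)) refl z x) (≡⇒diff≡0 e)))
      where
      x≢x+1 : ¬ x ≡ x + 1#
      x≢x+1 e = 1≢0 (lincomb₁ (- 1#) e
        (solve 1 (λ x → one :- nil := (:- one) :* (x :- (x :+ one))) refl x))

  -- Odd characteristic: square roots of -1 and q modulo 4.

  module OddCharacteristic (2≢0 : ¬ 1# + 1# ≡ 0#) where

    x≢-x : ∀ {x} → ¬ x ≡ 0# → ¬ x ≡ - x
    x≢-x {x} x≢0 e = x≢0 (x*y≡0⇒y≡0 2≢0 (trans (solve 1 (λ x → two :* x := x :- :- x) refl x) (≡⇒diff≡0 e)))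

    opposite-squares : ∀ {s x y} → ¬ s ≡ 0# → x * x ≡ s → y * y ≡ - s → ¬ x ≡ y
    opposite-squares s≢0 x² y² refl = x≢-x s≢0 (trans (sym x²) y²)

    -- Multiplication by i makes the fibres of x ↦ x⁴ on nonzero elements have exactly four elements.
    -1-square⇒order : IsSquare (- 1#) → q ℕ.% 4 ≡ 1
    -1-square⇒order (i , i²) = order-mod 4 (λ x → x * x * (x * x)) (0# ∷ []) ([] ∷ []) fib
      where
      fib : ∀ {x} → x ∉ 0# ∷ [] → FibreOutside 4 (λ x → x * x * (x * x)) (0# ∷ []) x
      fib {x} x∉ = x ∷ - x ∷ i * x ∷ - (i * x) ∷ [] , refl
        , ((x≢-x x≢0 ∷ opp refl ixix ∷ opp refl -ixix ∷ [])
          ∷ (opp -x-x ixix ∷ opp -x-x -ixix ∷ [])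
          ∷ (x≢-x ix≢0 ∷ []) ∷ [] ∷ [])
        , (λ { (here refl) → x∉ , refl
             ; (there (here refl)) → nz (-‿nonzero x≢0) , cong₂ _*_ -x-x -x-x
             ; (there (there (here refl))) → nz ix≢0 , trans (cong₂ _*_ ixix ixix) -·-
             ; (there (there (there (here refl)))) → nz (-‿nonzero ix≢0) , trans (cong₂ _*_ -ixix -ixix) -·- })
        , λ {z} _ e → from z (squares-equal e)
        where
        x≢0 : ¬ x ≡ 0#
        x≢0 e = x∉ (here e)
        nz : ∀ {z} → ¬ z ≡ 0# → z ∉ 0# ∷ []
        nz z≢0 (here e) = z≢0 e
        i≢0 : ¬ i ≡ 0#
        i≢0 refl = -‿nonzero 1≢0 (trans (sym i²) (zeroˡ _))
        ix≢0 : ¬ i * x ≡ 0#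
        ix≢0 = *-nonzero i≢0 x≢0
        opp : ∀ {y z} → y * y ≡ x * x → z * z ≡ - (x * x) → ¬ y ≡ z
        opp = opposite-squares (*-nonzero x≢0 x≢0)
        -x-x : - x * - x ≡ x * x
        -x-x = solve 1 (λ x → (:- x) :* (:- x) := x :* x) refl x
        ixix : i * x * (i * x) ≡ - (x * x)
        ixix = lincomb₁ (x * x) i² (solve 2 (λ i x → i :* x :* (i :* x) :- (:- (x :* x)) := x :* x :* (i :* i :- :- one)) refl i x)
        -ixix : - (i * x) * - (i * x) ≡ - (x * x)
        -ixix = trans (solve 1 (λ x → (:- x) :* (:- x) := x :* x) refl (i * x)) ixix
        -·- : - (x * x) * - (x * x) ≡ x * x * (x * x)
        -·- = solve 1 (λ x → (:- x) :* (:- x) := x :* x) refl (x * x)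
        from : ∀ z → z * z ≡ x * x ⊎ z * z ≡ - (x * x) → z ∈ x ∷ - x ∷ i * x ∷ - (i * x) ∷ []
        from z (inj₁ e) = [ here , there ∘ here ]′ (squares-equal e)
        from z (inj₂ e) = [ there ∘ there ∘ here , there ∘ there ∘ there ∘ here ]′ (squares-equal (trans e (sym ixix)))

    -- Without a square root of -1 the fibres of x ↦ x² + x⁻² away from 0 and ±1 are the quadruples {±x , ±x⁻¹}.
    -1-nonsquare⇒order : ¬ IsSquare (- 1#) → q ℕ.% 4 ≡ 3
    -1-nonsquare⇒order no-i = order-mod 4 φ ys
      ((1≢0 ∘ sym ∷ (-‿nonzero 1≢0) ∘ sym ∷ []) ∷ (x≢-x 1≢0 ∷ []) ∷ [] ∷ []) fib
      where
      ys : List Carrier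
      -- At 0 the inverse is a dummy, and at ±1 an element is its own inverse, so the quadruple
      -- degenerates. These three elements are the remainder modulo 4.
      ys = 0# ∷ 1# ∷ - 1# ∷ []
      φ : Carrier → Carrier
      φ x = x * x + inv x * inv x
      -·- : ∀ x → - x * - x ≡ x * x
      -·- = solve 1 (λ x → (:- x) :* (:- x) := x :* x) refl
      outside : ∀ {z} → ¬ z ≡ 0# → ¬ z * z ≡ 1# → z ∉ ys
      outside z≢0 z²≢1 (here e) = z≢0 e
      outside z≢0 z²≢1 (there (here refl)) = z²≢1 (*-identityˡ 1#)
      outside z≢0 z²≢1 (there (there (here refl))) = z²≢1 (trans (-·- 1#) (*-identityˡ 1#))
      z²≡1⇒ : ∀ {z} → z * z ≡ 1# → z ≡ 1# ⊎ z ≡ - 1#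
      z²≡1⇒ e = squares-equal (trans e (sym (*-identityˡ 1#)))
      fib : ∀ {x} → x ∉ ys → FibreOutside 4 φ ys x
      fib {x} x∉ = x ∷ - x ∷ y ∷ - y ∷ [] , refl
        , ((x≢-x x≢0 ∷ x≢y ∷ x≢-y ∷ [])
          ∷ ((λ e → x≢-y (trans (sym (-‿involutive x)) (cong -_ e))) ∷ (λ e → x≢y (trans (sym (-‿involutive x)) (trans (cong -_ e) (-‿involutive y)))) ∷ [])
          ∷ (x≢-x y≢0 ∷ []) ∷ [] ∷ [])
        , (λ { (here refl) → x∉ , refl
             ; (there (here refl)) → outside (-‿nonzero x≢0) (x²≢1 ∘ trans (sym (-·- x)))
                 , cong₂ _+_ (-·- x) (trans (cong₂ _*_ inv-x inv-x) (-·- y))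
             ; (there (there (here refl))) → outside y≢0 y²≢1
                 , trans (cong (y * y +_) (cong₂ _*_ inv-y inv-y)) swap
             ; (there (there (there (here refl)))) → outside (-‿nonzero y≢0) (y²≢1 ∘ trans (sym (-·- y)))
                 , trans (cong₂ _+_ (-·- y) (trans (cong₂ _*_ inv--y inv--y) (-·- x))) swap })
        , λ {z} z∉ e → from z (λ z≡0 → z∉ (here z≡0)) e
        where
        y : Carrier
        y = inv x
        x≢0 : ¬ x ≡ 0#
        x≢0 e = x∉ (here e)
        x²≢1 : ¬ x * x ≡ 1#
        x²≢1 e = [ (λ h → x∉ (there (here h))) , (λ h → x∉ (there (there (here h)))) ]′ (z²≡1⇒ e)
        xy≡1 : x * y ≡ 1#
        xy≡1 = inv-inverseʳ x≢0
        y≢0 : ¬ y ≡ 0#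
        y≢0 = inv-nonzero x≢0
        y²≢1 : ¬ y * y ≡ 1#
        y²≢1 e = x²≢1 (lincomb₂ (- (x * x)) (x * y + 1#) e xy≡1
          (solve 2 (λ x y → x :* x :- one := (:- (x :* x)) :* (y :* y :- one) :+ (x :* y :+ one) :* (x :* y :- one)) refl x y))
        x≢y : ¬ x ≡ y
        x≢y e = x²≢1 (trans (cong (x *_) e) xy≡1)
        x≢-y : ¬ x ≡ - y
        -- From x = - x⁻¹ follows x² = -1; the absence of such a root is what keeps the quadruple
        -- from shrinking to a pair.
        x≢-y e = no-i (x , lincomb₂ x (- 1#) e xy≡1
          (solve 2 (λ x y → x :* x :- :- one := x :* (x :- :- y) :+ (:- one) :* (x :* y :- one)) refl x y))
        inv-x : inv (- x) ≡ - y
        inv-x = inv-unique (trans (solve 2 (λ x y → (:- x) :* (:- y) := x :* y) refl x y) xy≡1)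
        inv-y : inv y ≡ x
        inv-y = inv-unique (trans (*-comm y x) xy≡1)
        inv--y : inv (- y) ≡ - x
        inv--y = inv-unique (trans (solve 2 (λ x y → (:- y) :* (:- x) := x :* y) refl x y) xy≡1)
        swap : y * y + x * x ≡ x * x + y * y
        swap = solve 2 (λ a b → a :+ b := b :+ a) refl (y * y) (x * x)
        from : ∀ z → ¬ z ≡ 0# → φ z ≡ φ x → z ∈ x ∷ - x ∷ y ∷ - y ∷ []
        from z z≢0 e = [ [ here , there ∘ here ]′ ∘ squares-equal ∘ diff≡0⇒≡
                       , [ there ∘ there ∘ here ∘ z≡y , there ∘ there ∘ there ∘ here ∘ z≡-y ]′ ∘ z²≡1⇒ ∘ zx-square ]′
          (x*y≡0⇒x≡0∨y≡0 product≡0)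
          where
          -- Clearing denominators in z² + z⁻² = x² + x⁻² gives this factorisation; the factors
          -- yield z = ±x and z = ±x⁻¹.
          product≡0 : (z * z + - (x * x)) * (z * z * (x * x) + - 1#) ≡ 0#
          product≡0 = lincomb₃ (z * z * (x * x)) (- (x * x) * (z * inv z + 1#)) (z * z * (x * y + 1#))
            e (inv-inverseʳ z≢0) xy≡1
            (solve 4 (λ z z′ x y → (z :* z :- x :* x) :* (z :* z :* (x :* x) :- one) :- nil
                := z :* z :* (x :* x) :* ((z :* z :+ z′ :* z′) :- (x :* x :+ y :* y))
                   :+ (:- (x :* x)) :* (z :* z′ :+ one) :* (z :* z′ :- one)
                   :+ z :* z :* (x :* y :+ one) :* (x :* y :- one)) refl z (inv z) x y)
          zx-square : z * z * (x * x) + - 1# ≡ 0# → z * x * (z * x) ≡ 1#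
          zx-square h = trans (solve 2 (λ z x → z :* x :* (z :* x) := z :* z :* (x :* x)) refl z x) (diff≡0⇒≡ h)
          z≡y : z * x ≡ 1# → z ≡ y
          z≡y zx≡1 = lincomb₂ (- z) y xy≡1 zx≡1
            (solve 3 (λ z x y → z :- y := (:- z) :* (x :* y :- one) :+ y :* (z :* x :- one)) refl z x y)
          z≡-y : z * x ≡ - 1# → z ≡ - y
          z≡-y zx≡-1 = lincomb₂ (- z) y xy≡1 zx≡-1
            (solve 3 (λ z x y → z :- (:- y) := (:- z) :* (x :* y :- one) :+ y :* (z :* x :- :- one)) refl z x y)

    -- Signs, and the pigeonhole principle for quadratic maps.

    -- Picks one element from each pair x, -x of nonzero elements by comparing their places in the
    -- enumeration. Zero is not positive.
    positive : Carrier → Bool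
    positive x = does (index x Fin.<? index (- x))

    positive-neg : ∀ {x} → ¬ x ≡ 0# → ¬ positive (- x) ≡ positive x
    positive-neg {x} x≢0 e with Fin.<-cmp (index x) (index (- x))
    ... | tri< x< _ x≯ = contradiction (trans (sym (dec-false (index (- x) Fin.<? index (- - x))
            (x≯ ∘ subst (λ y → index (- x) Fin.< index y) (-‿involutive x)))) (trans e (dec-true (index x Fin.<? index (- x)) x<))) λ ()
    ... | tri≈ _ x≡-x _ = x≢-x x≢0 (index-injective x≡-x)
    ... | tri> x≮ _ x> = contradiction (trans (sym (dec-true (index (- x) Fin.<? index (- - x))
            (subst (λ y → index (- x) Fin.< index y) (sym (-‿involutive x)) x>))) (trans e (dec-false (index x Fin.<? index (- x)) x≮))) λ ()

    -0≡0 : - 0# ≡ 0#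
    -0≡0 = solve 0 (:- nil := nil) refl

    positive⇒≢0 : ∀ {x} → positive x ≡ true → ¬ x ≡ 0#
    positive⇒≢0 e refl = contradiction (trans (sym e)
      (dec-false (index 0# Fin.<? index (- 0#)) (λ l → Fin.<-irrefl (cong index (sym -0≡0)) l))) λ ()

    sign-determines-root : ∀ {x y} → x * x ≡ y * y → positive x ≡ positive y → x ≡ y
    sign-determines-root {x} {y} sq e = [ id , opposite ]′ (squares-equal sq)
      where
      opposite : x ≡ - y → x ≡ y
      opposite refl with y ≟ 0#
      ... | yes refl = -0≡0
      ... | no y≢0   = contradiction e (positive-neg y≢0)

    -- Using f on one half of the field and g on the other gives a map F → F, which cannot be both injective and miss k.
    collision : (f g : Carrier → Carrier) → (∀ {x y} → f x ≡ f y → x * x ≡ y * y) →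
      (∀ {x y} → g x ≡ g y → x * x ≡ y * y) → ∀ k →
      (∃ λ x → f x ≡ k) ⊎ (∃ λ y → ¬ y ≡ 0# × g y ≡ k) ⊎ (∃₂ λ x y → ¬ y ≡ 0# × f x ≡ g y)
    collision f g f-even g-even k
      with any? (λ x → f x ≟ k)
         | any? (λ y → ¬? (y ≟ 0#) ×-dec (g y ≟ k))
         | any? (λ x → any? (λ y → ¬? (y ≟ 0#) ×-dec (f x ≟ g y)))
    ... | yes a | _ | _ = inj₁ a
    ... | no _  | yes b | _ = inj₂ (inj₁ b)
    ... | no _  | no _ | yes c = inj₂ (inj₂ c)
    ... | no ¬a | no ¬b | no ¬c = contradiction (λ {x} {y} → inj x y) (no-injection h)
      where
      branch : Bool → Carrier → Carrier
      branch true  = g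
      branch false = f
      h : Maybe Carrier → Carrier
      -- The value k sits at ∞: if it were missed and the two halves injected disjointly, F ∪ {∞}
      -- would embed into F.
      h nothing  = k
      h (just x) = branch (positive x) x
      missed : ∀ {x} b → positive x ≡ b → ¬ branch b x ≡ k
      missed true  p e = ¬b (_ , positive⇒≢0 p , e)
      missed false p e = ¬a (_ , e)
      branch-inj : ∀ {x y} b b′ → positive x ≡ b → positive y ≡ b′ → branch b x ≡ branch b′ y → x ≡ y
      branch-inj true  true  p p′ e = sign-determines-root (g-even e) (trans p (sym p′))
      branch-inj false false p p′ e = sign-determines-root (f-even e) (trans p (sym p′))
      branch-inj true  false p p′ e = contradiction (_ , _ , positive⇒≢0 p , sym e) ¬c
      branch-inj false true  p p′ e = contradiction (_ , _ , positive⇒≢0 p′ , e) ¬c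
      inj : ∀ x y → h x ≡ h y → x ≡ y
      inj nothing  nothing  e = refl
      inj nothing  (just y) e = contradiction (sym e) (missed (positive y) refl)
      inj (just x) nothing  e = contradiction e (missed (positive x) refl)
      inj (just x) (just y) e = cong just (branch-inj (positive x) (positive y) refl refl e)

    -- A common value of α x² and κ - β y² solves the equation. Of the other outcomes of
    -- `collision`, α x² = κ is a solution with y = 0, and κ - β y² = κ is impossible because
    -- `collision` delivers y ≠ 0.
    diagonal-form-universal : ∀ {α β} → ¬ α ≡ 0# → ¬ β ≡ 0# → ∀ κ → ∃₂ λ x y → α * (x * x) + β * (y * y) ≡ κ
    diagonal-form-universal {α} {β} α≢0 β≢0 κ =
      cases (collision (λ x → α * (x * x)) (λ y → κ + - (β * (y * y))) (*-cancelˡ α≢0) (*-cancelˡ β≢0 ∘ cancel) κ)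
      where
      cancel : ∀ {a b} → κ + - a ≡ κ + - b → a ≡ b
      cancel {a} {b} e = lincomb₁ (- 1#) e (solve 3 (λ k a b → a :- b := (:- one) :* ((k :- a) :- (k :- b))) refl κ a b)
      cases : (∃ λ x → α * (x * x) ≡ κ) ⊎ (∃ λ y → ¬ y ≡ 0# × κ + - (β * (y * y)) ≡ κ)
        ⊎ (∃₂ λ x y → ¬ y ≡ 0# × α * (x * x) ≡ κ + - (β * (y * y))) → ∃₂ λ x y → α * (x * x) + β * (y * y) ≡ κ
      cases (inj₁ (x , e)) = x , 0# , trans (solve 2 (λ a b → a :+ b :* (nil :* nil) := a) refl (α * (x * x)) β) e
      cases (inj₂ (inj₁ (y , y≢0 , e))) = contradiction
        (lincomb₁ (- 1#) e (solve 2 (λ k b → b :- nil := (:- one) :* ((k :- b) :- k)) refl κ (β * (y * y))))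
        (*-nonzero β≢0 (*-nonzero y≢0 y≢0))
      cases (inj₂ (inj₂ (x , y , _ , e))) = x , y , lincomb₁ 1# e
        (solve 3 (λ k a b → (a :+ b) :- k := one :* (a :- (k :- b))) refl κ (α * (x * x)) (β * (y * y)))

    nonsquare⇒≢0 : ∀ {x} → ¬ IsSquare x → ¬ x ≡ 0#
    nonsquare⇒≢0 ns refl = ns (0# , zeroˡ 0#)

    -- `collision` for x² and δ y² with target η: η = x² contradicts `nsη`, x² = δ y² with y ≠ 0
    -- would make δ a square, and η = δ y² is the claim.
    nonsquares-proportional : ∀ {δ η} → ¬ IsSquare δ → ¬ IsSquare η → ∃ λ w → ¬ w ≡ 0# × δ * (w * w) ≡ η
    nonsquares-proportional {δ} {η} nsδ nsη =
      [ (λ s → contradiction s nsη) , [ id , (λ (x , y , y≢0 , e) → contradiction (x * inv y , quotient x y≢0 e) nsδ) ]′ ]′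
        (collision (λ x → x * x) (λ y → δ * (y * y)) id (*-cancelˡ (nonsquare⇒≢0 nsδ)) η)
      where
      quotient : ∀ x {y} → ¬ y ≡ 0# → x * x ≡ δ * (y * y) → x * inv y * (x * inv y) ≡ δ
      quotient x {y} y≢0 e = lincomb₂ (inv y * inv y) (δ * (y * inv y + 1#)) e (inv-inverseʳ y≢0)
        (solve 4 (λ d x y i → x :* i :* (x :* i) :- d
           := i :* i :* (x :* x :- d :* (y :* y)) :+ d :* (y :* i :+ one) :* (y :* i :- one)) refl δ x y (inv y))

    -- Square roots, signs and the points of an ellipse.

    root : Carrier → Carrier
    root x with isSquare? x
    ... | yes (y , _) = y
    ... | no _        = 0#

    root-square : ∀ {x} → IsSquare x → root x * root x ≡ x
    root-square {x} sq with isSquare? x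
    ... | yes (_ , e) = e
    ... | no ¬sq      = contradiction sq ¬sq

    sgn : Carrier → Carrier
    sgn x = if positive x then 1# else - 1#

    sgn-square : ∀ x → sgn x * sgn x ≡ 1#
    sgn-square x with positive x
    ... | true  = *-identityˡ 1#
    ... | false = solve 0 ((:- one) :* (:- one) := one) refl

    sgn-positive : ∀ x y → sgn x ≡ sgn y → positive x ≡ positive y
    sgn-positive x y e with positive x | positive y
    ... | true  | true  = refl
    ... | false | false = refl
    ... | true  | false = contradiction e (x≢-x 1≢0)
    ... | false | true  = contradiction (sym e) (x≢-x 1≢0)

    -- A conic α x² + β y² = κ without points at infinity has q + 1 points, one for each element of F ∪ {∞}.
    module Ellipse {α β κ : Carrier} (-αβ-nonsquare : ¬ IsSquare (- (α * β))) (κ≢0 : ¬ κ ≡ 0#)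
      (x₀ y₀ : Carrier) (on₀ : α * (x₀ * x₀) + β * (y₀ * y₀) ≡ κ) where

      den : Carrier → Carrier
      den t = t * t + α * β

      den≢0 : ∀ t → ¬ den t ≡ 0#
      den≢0 t e = -αβ-nonsquare (t , lincomb₁ 1# e
        (solve 2 (λ a b → a :- :- b := one :* ((a :+ b) :- nil)) refl (t * t) (α * β)))

      -- With ω² = - α β, cos t + sin t ω is (t + ω) / (t - ω), an element of norm one in the
      -- quadratic extension; t = ∞ gives 1.
      cos sin : Maybe Carrier → Carrier
      cos nothing  = 1#
      cos (just t) = (t * t + - (α * β)) * inv (den t)
      sin nothing  = 0#
      sin (just t) = (1# + 1#) * t * inv (den t)

      cos²+αβsin²≡1 : ∀ t → cos t * cos t + α * β * (sin t * sin t) ≡ 1#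
      cos²+αβsin²≡1 nothing  = solve 1 (λ p → one :* one :+ p :* (nil :* nil) := one) refl (α * β)
      cos²+αβsin²≡1 (just t) = lincomb₁ (den t * inv (den t) + 1#) (inv-inverseʳ (den≢0 t))
        (solve 3 (λ t p i → ((t :* t :- p) :* i :* ((t :* t :- p) :* i) :+ p :* (two :* t :* i :* (two :* t :* i))) :- one
           := ((t :* t :+ p) :* i :+ one) :* ((t :* t :+ p) :* i :- one)) refl t (α * β) (inv (den t)))

      -- The right side never vanishes, so only ∞ has cosine 1. It also shows that cos t determines
      -- the denominator, after which sin t determines t.
      cos-1 : ∀ t → 1# + - cos (just t) ≡ (1# + 1#) * (α * β) * inv (den t)
      cos-1 t = lincomb₁ (- 1#) (inv-inverseʳ (den≢0 t))
        (solve 3 (λ t p i → (one :- (t :* t :- p) :* i) :- two :* p :* i := (:- one) :* ((t :* t :+ p) :* i :- one)) refl t (α * β) (inv (den t)))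

      αβ≢0 : ¬ α * β ≡ 0#
      αβ≢0 e = nonsquare⇒≢0 -αβ-nonsquare (trans (cong -_ e) -0≡0)

      inv-den≢0 : ∀ t → ¬ inv (den t) ≡ 0#
      inv-den≢0 t = inv-nonzero (den≢0 t)

      2αβ≢0 : ¬ (1# + 1#) * (α * β) ≡ 0#
      2αβ≢0 = *-nonzero 2≢0 αβ≢0

      cos≢1 : ∀ t → ¬ 1# ≡ cos (just t)
      cos≢1 t e = *-nonzero 2αβ≢0 (inv-den≢0 t) (trans (sym (cos-1 t)) (≡⇒diff≡0 e))

      angle-injective : ∀ s t → cos s ≡ cos t → sin s ≡ sin t → s ≡ t
      angle-injective nothing  nothing  _ _ = refl
      angle-injective nothing  (just t) c _ = contradiction c (cos≢1 t)
      angle-injective (just s) nothing  c _ = contradiction (sym c) (cos≢1 s)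
      angle-injective (just s) (just t) c e = cong just (*-cancelˡ 2≢0 (*-cancelˡ (inv-den≢0 s)
        (trans (*-comm _ _) (trans e (trans (*-comm _ _) (cong (_* ((1# + 1#) * t)) (sym inv-eq)))))))
        where
        inv-eq : inv (den s) ≡ inv (den t)
        inv-eq = *-cancelˡ 2αβ≢0 (trans (sym (cos-1 s)) (trans (cong (λ c → 1# + - c) c) (cos-1 t)))

      -- Rotation of the base point: α px + ω py is (cos t + sin t ω)(α x₀ + ω y₀), where the norm
      -- of α x + ω y is α (α x² + β y²).
      px py : Maybe Carrier → Carrier
      px t = cos t * x₀ + - (β * sin t * y₀)
      py t = cos t * y₀ + α * sin t * x₀

      on-ellipse : ∀ t → α * (px t * px t) + β * (py t * py t) ≡ κ
      on-ellipse t = lincomb₂ (cos t * cos t + α * β * (sin t * sin t)) κ on₀ (cos²+αβsin²≡1 t)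
        (solve 7 (λ a b k c s x y →
            (a :* ((c :* x :- b :* s :* y) :* (c :* x :- b :* s :* y)) :+ b :* ((c :* y :+ a :* s :* x) :* (c :* y :+ a :* s :* x))) :- k
            := (c :* c :+ a :* b :* (s :* s)) :* ((a :* (x :* x) :+ b :* (y :* y)) :- k)
               :+ k :* ((c :* c :+ a :* b :* (s :* s)) :- one))
          refl α β κ (cos t) (sin t) x₀ y₀)

      cos-from-point : ∀ t → α * x₀ * px t + β * y₀ * py t ≡ κ * cos t
      cos-from-point t = lincomb₁ (cos t) on₀
        (solve 7 (λ a b k c s x y →
            (a :* x :* (c :* x :- b :* s :* y) :+ b :* y :* (c :* y :+ a :* s :* x)) :- k :* c
            := c :* ((a :* (x :* x) :+ b :* (y :* y)) :- k))
          refl α β κ (cos t) (sin t) x₀ y₀)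

      sin-from-point : ∀ t → x₀ * py t + - (y₀ * px t) ≡ κ * sin t
      sin-from-point t = lincomb₁ (sin t) on₀
        (solve 7 (λ a b k c s x y →
            (x :* (c :* y :+ a :* s :* x) :- y :* (c :* x :- b :* s :* y)) :- k :* s
            := s :* ((a :* (x :* x) :+ b :* (y :* y)) :- k))
          refl α β κ (cos t) (sin t) x₀ y₀)

      point-injective : ∀ s t → px s ≡ px t → py s ≡ py t → s ≡ t
      point-injective s t ex ey = angle-injective s t
        (*-cancelˡ κ≢0 (trans (sym (cos-from-point s)) (trans (cong₂ (λ x y → α * x₀ * x + β * y₀ * y) ex ey) (cos-from-point t))))
        (*-cancelˡ κ≢0 (trans (sym (sin-from-point s)) (trans (cong₂ (λ x y → x₀ * y + - (y₀ * x)) ex ey) (sin-from-point t))))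

      α≢0 : ¬ α ≡ 0#
      α≢0 e = αβ≢0 (trans (cong (_* β) e) (zeroˡ β))

      -- If w² = y² - h² then y ± w determines y, because (y + w)(y - w) = h²; the sign of x decides between the
      -- two values y ± w, so the q + 1 points of the ellipse would inject into the field.
      y²-h²-not-always-square : ∀ {h} → ¬ h ≡ 0# →
        ¬ (∀ x y → α * (x * x) + β * (y * y) ≡ κ → ∃ λ w → ¬ w ≡ 0# × w * w ≡ y * y + - (h * h))
      y²-h²-not-always-square {h} h≢0 H = no-injection value (λ {s} {t} → value-inj s t)
        where
        w : Carrier → Carrier
        w y = root (y * y + - (h * h))
        w-square : ∀ t → w (py t) * w (py t) ≡ py t * py t + - (h * h)
        w-square t = let v , _ , e = H (px t) (py t) (on-ellipse t) in root-square (v , e)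
        w≢0 : ∀ t → ¬ w (py t) ≡ 0#
        w≢0 t e = let v , v≢0 , e′ = H (px t) (py t) (on-ellipse t) in *-nonzero v≢0 v≢0
          (trans e′ (trans (sym (w-square t)) (trans (cong (_* w (py t)) e) (zeroˡ _))))
        value : Maybe Carrier → Carrier
        value t = py t + sgn (px t) * w (py t)
        value-equation : ∀ t → value t * ((1# + 1#) * py t + - value t) ≡ h * h
        value-equation t = lincomb₂ (- (sgn (px t) * sgn (px t))) (- (py t * py t) + h * h) (w-square t) (sgn-square (px t))
          (solve 4 (λ y s w h → ((y :+ s :* w) :* (two :* y :- (y :+ s :* w))) :- h :* h
             := (:- (s :* s)) :* (w :* w :- (y :* y :- h :* h)) :+ (:- (y :* y) :+ h :* h) :* (s :* s :- one))
            refl (py t) (sgn (px t)) (w (py t)) h)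
        value≢0 : ∀ t → ¬ value t ≡ 0#
        value≢0 t e = *-nonzero h≢0 h≢0 (trans (sym (value-equation t))
          (trans (cong (_* ((1# + 1#) * py t + - value t)) e) (zeroˡ _)))
        value-inj : ∀ s t → value s ≡ value t → s ≡ t
        value-inj s t e = point-injective s t
          (sign-determines-root (*-cancelˡ α≢0 x²) (sgn-positive (px s) (px t) sgn-eq)) y-eq
          where
          y-eq : py s ≡ py t
          -- The equal values are nonzero and cancel from v (2 y - v) = h², which leaves equal 2 y -
          -- v.
          y-eq = *-cancelˡ 2≢0 (lincomb₂ 1# 1# {a = (1# + 1#) * py s + - value s} {b = (1# + 1#) * py t + - value t}
            (*-cancelˡ (value≢0 s) (trans (value-equation s) (trans (sym (value-equation t))
               (cong (_* ((1# + 1#) * py t + - value t)) (sym e))))) e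
            (solve 4 (λ a b v v′ → a :- b := one :* ((a :- v) :- (b :- v′)) :+ one :* (v :- v′)) refl
               ((1# + 1#) * py s) ((1# + 1#) * py t) (value s) (value t)))
          sgn-eq : sgn (px s) ≡ sgn (px t)
          -- Equal y give the same chosen root w; as w ≠ 0, the sign in front of it can be read off.
          sgn-eq = *-cancelˡ (w≢0 s) (lincomb₂ 1# (- 1#) (trans e (cong (λ y → y + sgn (px t) * w y) (sym y-eq))) refl
            (solve 4 (λ w a b y → w :* a :- w :* b := one :* ((y :+ a :* w) :- (y :+ b :* w)) :+ (:- one) :* (y :- y))
               refl (w (py s)) (sgn (px s)) (sgn (px t)) (py s)))
          x² : α * (px s * px s) ≡ α * (px t * px t)
          x² = lincomb₂ 1# 1# (trans (on-ellipse s) (sym (on-ellipse t))) (cong (λ y → β * (y * y)) (sym y-eq))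
            (solve 4 (λ a b c d → a :- c := one :* ((a :+ b) :- (c :+ d)) :+ one :* (d :- b))
               refl (α * (px s * px s)) (β * (py s * py s)) (α * (px t * px t)) (β * (py t * py t)))

-- Linear algebra of points and lines.

module ProjectivePlane {q : ℕ} (F : FiniteField q) where
  open FiniteField F
  open Geometry F
  open FieldTheory F

  dot : Vec3 → Vec3 → Carrier
  dot u v = x u * x v + y u * y v + z u * z v

  cross : Vec3 → Vec3 → Vec3
  cross u v = ⟨ y u * z v + - (z u * y v) , z u * x v + - (x u * z v) , x u * y v + - (y u * x v) ⟩

  comb : Carrier → Vec3 → Carrier → Vec3 → Vec3
  comb s u t v = ⟨ s * x u + t * x v , s * y u + t * y v , s * z u + t * z v ⟩

  0⃗ : Vec3
  0⃗ = ⟨ 0# , 0# , 0# ⟩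

  vec≡ : ∀ {u v} → x u ≡ x v → y u ≡ y v → z u ≡ z v → u ≡ v
  vec≡ refl refl refl = refl

  zero-or-nonzero : ∀ v → v ≡ 0⃗ ⊎ NonZero3 v
  zero-or-nonzero v with x v ≟ 0# | y v ≟ 0# | z v ≟ 0#
  ... | yes p | yes q | yes r = inj₁ (vec≡ p q r)
  ... | no ¬p | _     | _     = inj₂ (¬p ∘ proj₁)
  ... | yes _ | no ¬q | _     = inj₂ (¬q ∘ proj₁ ∘ proj₂)
  ... | yes _ | yes _ | no ¬r = inj₂ (¬r ∘ proj₂ ∘ proj₂)

  nonzero⇒≢ : ∀ {v} → NonZero3 v → ¬ v ≡ 0⃗
  nonzero⇒≢ nz refl = nz (refl , refl , refl)

  ≢⇒nonzero : ∀ {v} → ¬ v ≡ 0⃗ → NonZero3 v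
  ≢⇒nonzero v≢0 (p , q , r) = v≢0 (vec≡ p q r)

  dot-comm : ∀ u v → dot u v ≡ dot v u
  dot-comm u v = solve 6 (λ a b c d e f → a :* d :+ b :* e :+ c :* f := d :* a :+ e :* b :+ f :* c)
    refl (x u) (y u) (z u) (x v) (y v) (z v)

  dot-zeroʳ : ∀ u → dot u 0⃗ ≡ 0#
  dot-zeroʳ u = solve 3 (λ a b c → a :* nil :+ b :* nil :+ c :* nil := nil) refl (x u) (y u) (z u)

  dot-comb : ∀ w s u t v → dot w (comb s u t v) ≡ s * dot w u + t * dot w v
  dot-comb w s u t v = solve 11 (λ a b c s d e f t g h i →
      a :* (s :* d :+ t :* g) :+ b :* (s :* e :+ t :* h) :+ c :* (s :* f :+ t :* i)
      := s :* (a :* d :+ b :* e :+ c :* f) :+ t :* (a :* g :+ b :* h :+ c :* i))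
    refl (x w) (y w) (z w) s (x u) (y u) (z u) t (x v) (y v) (z v)

  dot-scale : ∀ w k v → dot w (scale k v) ≡ k * dot w v
  dot-scale w k v = solve 7 (λ a b c k d e f →
      a :* (k :* d) :+ b :* (k :* e) :+ c :* (k :* f) := k :* (a :* d :+ b :* e :+ c :* f))
    refl (x w) (y w) (z w) k (x v) (y v) (z v)

  dot-scaleˡ : ∀ k v w → dot (scale k v) w ≡ k * dot v w
  dot-scaleˡ k v w = trans (dot-comm (scale k v) w) (trans (dot-scale w k v) (cong (k *_) (dot-comm w v)))

  dot-crossˡ : ∀ u v → dot u (cross u v) ≡ 0#
  dot-crossˡ u v = solve 6 (λ a b c d e f →
      a :* (b :* f :- c :* e) :+ b :* (c :* d :- a :* f) :+ c :* (a :* e :- b :* d) := nil)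
    refl (x u) (y u) (z u) (x v) (y v) (z v)

  dot-crossʳ : ∀ u v → dot v (cross u v) ≡ 0#
  dot-crossʳ u v = solve 6 (λ a b c d e f →
      d :* (b :* f :- c :* e) :+ e :* (c :* d :- a :* f) :+ f :* (a :* e :- b :* d) := nil)
    refl (x u) (y u) (z u) (x v) (y v) (z v)

  -- (u × v) × n = (n · u) v - (n · v) u
  cross-normal : ∀ u v n → dot n u ≡ 0# → dot n v ≡ 0# → cross (cross u v) n ≡ 0⃗
  cross-normal u v n nu nv = vec≡
    (lincomb₂ (x v) (- x u) nu nv (identity (x u) (y u) (z u) (x v) (y v) (z v) (x n) (y n) (z n)))
    (lincomb₂ (y v) (- y u) (trans rotate nu) (trans rotate nv)
      (identity (y u) (z u) (x u) (y v) (z v) (x v) (y n) (z n) (x n)))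
    (lincomb₂ (z v) (- z u) (trans (sym rotate) nu) (trans (sym rotate) nv)
      (identity (z u) (x u) (y u) (z v) (x v) (y v) (z n) (x n) (y n)))
    where
    rotate : ∀ {r s t} → s + t + r ≡ r + s + t
    rotate {r} {s} {t} = solve 3 (λ r s t → s :+ t :+ r := r :+ s :+ t) refl r s t
    identity : ∀ a b c d e f g h i → (c * d + - (a * f)) * i + - ((a * e + - (b * d)) * h) + - 0#
      ≡ d * (g * a + h * b + i * c + - 0#) + - a * (g * d + h * e + i * f + - 0#)
    identity = solve 9 (λ a b c d e f g h i → (c :* d :- a :* f) :* i :- (a :* e :- b :* d) :* h :- nil
      := d :* (g :* a :+ h :* b :+ i :* c :- nil) :+ (:- a) :* (g :* d :+ h :* e :+ i :* f :- nil)) refl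

  private
    quotient-self : ∀ {a d} → ¬ a ≡ 0# → d ≡ d * inv a * a
    quotient-self {a} {d} nz = lincomb₁ (- d) (inv-inverseʳ nz)
      (solve 3 (λ a d i → d :- d :* i :* a := (:- d) :* (a :* i :- one)) refl a d (inv a))

    quotient-⁺ : ∀ {a b d e} → ¬ a ≡ 0# → a * e + - (b * d) ≡ 0# → e ≡ d * inv a * b
    quotient-⁺ {a} {b} {d} {e} nz h = lincomb₂ (- e) (inv a) (inv-inverseʳ nz) h
      (solve 5 (λ a b d e i → e :- d :* i :* b
         := (:- e) :* (a :* i :- one) :+ i :* ((a :* e :- b :* d) :- nil)) refl a b d e (inv a))

    quotient-⁻ : ∀ {a b d e} → ¬ a ≡ 0# → b * d + - (a * e) ≡ 0# → e ≡ d * inv a * b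
    quotient-⁻ {a} {b} {d} {e} nz h = lincomb₂ (- e) (- inv a) (inv-inverseʳ nz) h
      (solve 5 (λ a b d e i → e :- d :* i :* b
         := (:- e) :* (a :* i :- one) :+ (:- i) :* ((b :* d :- a :* e) :- nil)) refl a b d e (inv a))

  -- A nonzero coordinate of u serves as pivot: the factor is the quotient of the two coordinates
  -- there, and the cross product settles the other positions.
  parallel : ∀ u v → NonZero3 u → cross u v ≡ 0⃗ → ∃ λ k → v ≡ scale k u
  parallel u v u≢0 c≡0 with x u ≟ 0# | y u ≟ 0# | z u ≟ 0#
  ... | yes p | yes q | yes r = contradiction (p , q , r) u≢0
  ... | no ¬p | _ | _ =
    x v * inv (x u) , vec≡ (quotient-self ¬p) (quotient-⁺ ¬p (cong z c≡0)) (quotient-⁻ ¬p (cong y c≡0))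
  ... | yes _ | no ¬q | _ =
    y v * inv (y u) , vec≡ (quotient-⁻ ¬q (cong z c≡0)) (quotient-self ¬q) (quotient-⁺ ¬q (cong x c≡0))
  ... | yes _ | yes _ | no ¬r =
    z v * inv (z u) , vec≡ (quotient-⁺ ¬r (cong y c≡0)) (quotient-⁻ ¬r (cong x c≡0)) (quotient-self ¬r)

  scale-zero : ∀ {k} v → k ≡ 0# → scale k v ≡ 0⃗
  scale-zero v refl = vec≡ (zeroˡ _) (zeroˡ _) (zeroˡ _)

  comb-zeroˡ : ∀ s t v → comb s 0⃗ t v ≡ scale t v
  comb-zeroˡ s t v = vec≡ (drop (x v)) (drop (y v)) (drop (z v))
    where
    drop : ∀ a → s * 0# + t * a ≡ t * a
    drop = solve 3 (λ s t a → s :* nil :+ t :* a := t :* a) refl s t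

  scale-inv : ∀ {k} v → ¬ k ≡ 0# → scale (inv k) (scale k v) ≡ v
  scale-inv {k} v k≢0 = vec≡ (cancel (x v)) (cancel (y v)) (cancel (z v))
    where
    cancel : ∀ a → inv k * (k * a) ≡ a
    cancel a = lincomb₁ a (inv-inverseʳ k≢0)
      (solve 3 (λ i k a → i :* (k :* a) :- a := a :* (k :* i :- one)) refl (inv k) k a)

  normals-parallel : ∀ {u v n} → NonZero3 (cross u v) → dot n u ≡ 0# → dot n v ≡ 0# → ∃ λ k → n ≡ scale k (cross u v)
  normals-parallel {u} {v} {n} c≢0 nu nv = parallel (cross u v) n c≢0 (cross-normal u v n nu nv)

  line-has-point : ∀ l → NonZero3 l → ∃ λ u → NonZero3 u × dot l u ≡ 0#
  line-has-point l l≢0 with x l ≟ 0# | y l ≟ 0#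
  ... | yes x≡0 | yes y≡0 = ⟨ 1# , 0# , 0# ⟩ , (1≢0 ∘ proj₁)
    , trans (cong₂ (λ a b → a * 1# + b * 0# + z l * 0#) x≡0 y≡0)
        (solve 1 (λ c → nil :* one :+ nil :* nil :+ c :* nil := nil) refl (z l))
  ... | no x≢0 | _ = ⟨ - y l , x l , 0# ⟩ , (x≢0 ∘ proj₁ ∘ proj₂)
    , solve 3 (λ a b c → a :* (:- b) :+ b :* a :+ c :* nil := nil) refl (x l) (y l) (z l)
  ... | yes _ | no y≢0 = ⟨ - y l , x l , 0# ⟩ , (-‿nonzero y≢0 ∘ proj₁)
    , solve 3 (λ a b c → a :* (:- b) :+ b :* a :+ c :* nil := nil) refl (x l) (y l) (z l)

  point-off-line : ∀ l → NonZero3 l → ∃ λ u → ¬ dot l u ≡ 0#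
  point-off-line l l≢0 with x l ≟ 0# | y l ≟ 0# | z l ≟ 0#
  ... | yes p | yes q | yes r = contradiction (p , q , r) l≢0
  ... | no ¬p | _ | _ = ⟨ 1# , 0# , 0# ⟩ , ¬p ∘ trans
    (solve 3 (λ a b c → a := a :* one :+ b :* nil :+ c :* nil) refl (x l) (y l) (z l))
  ... | yes _ | no ¬q | _ = ⟨ 0# , 1# , 0# ⟩ , ¬q ∘ trans
    (solve 3 (λ a b c → b := a :* nil :+ b :* one :+ c :* nil) refl (x l) (y l) (z l))
  ... | yes _ | yes _ | no ¬r = ⟨ 0# , 0# , 1# ⟩ , ¬r ∘ trans
    (solve 3 (λ a b c → c := a :* nil :+ b :* nil :+ c :* one) refl (x l) (y l) (z l))

  -- The polar form of a conic.

  module PolarForm (C : Conic) where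

    M : Vec3 → Vec3
    M v = ⟨ 2# * a C * x v + d C * y v + e C * z v
          , d C * x v + 2# * b C * y v + f C * z v
          , e C * x v + f C * y v + 2# * c C * z v ⟩

    B : Vec3 → Vec3 → Carrier
    B u v = dot u (M v)

    B-sym : ∀ u v → B u v ≡ B v u
    B-sym u v = solve 12 (λ a b c d e f u v w x y z →
        u :* (a :* x :+ d :* y :+ e :* z) :+ v :* (d :* x :+ b :* y :+ f :* z) :+ w :* (e :* x :+ f :* y :+ c :* z)
        := x :* (a :* u :+ d :* v :+ e :* w) :+ y :* (d :* u :+ b :* v :+ f :* w) :+ z :* (e :* u :+ f :* v :+ c :* w))
      refl (2# * a C) (2# * b C) (2# * c C) (d C) (e C) (f C) (x u) (y u) (z u) (x v) (y v) (z v)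

    B-combˡ : ∀ s u t v w → B (comb s u t v) w ≡ s * B u w + t * B v w
    B-combˡ s u t v w = trans (dot-comm _ (M w)) (trans (dot-comb (M w) s u t v)
      (cong₂ (λ p q → s * p + t * q) (dot-comm (M w) u) (dot-comm (M w) v)))

    B-combʳ : ∀ w s u t v → B w (comb s u t v) ≡ s * B w u + t * B w v
    B-combʳ w s u t v = trans (B-sym w _) (trans (B-combˡ s u t v w)
      (cong₂ (λ p q → s * p + t * q) (B-sym u w) (B-sym v w)))

    B-zeroˡ : ∀ v → B 0⃗ v ≡ 0#
    B-zeroˡ v = trans (dot-comm 0⃗ (M v)) (dot-zeroʳ (M v))

    B-scaleˡ : ∀ k u v → B (scale k u) v ≡ k * B u v
    B-scaleˡ k u v = dot-scaleˡ k u (M v)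

    B≢0⇒nonzero : ∀ {u} v → ¬ B u v ≡ 0# → NonZero3 u
    B≢0⇒nonzero {u} v h = ≢⇒nonzero λ u≡0 → h (trans (cong (λ w → B w v) u≡0) (B-zeroˡ v))

    B-diagonal : ∀ v → B v v ≡ 2# * evalC C v
    B-diagonal v = solve 9 (λ a b c d e f x y z →
        x :* (two :* a :* x :+ d :* y :+ e :* z) :+ y :* (d :* x :+ two :* b :* y :+ f :* z) :+ z :* (e :* x :+ f :* y :+ two :* c :* z)
        := two :* (a :* x :* x :+ b :* y :* y :+ c :* z :* z :+ d :* x :* y :+ e :* x :* z :+ f :* y :* z))
      refl (a C) (b C) (c C) (d C) (e C) (f C) (x v) (y v) (z v)

    B-comb-diagonal : ∀ s u t v → B (comb s u t v) (comb s u t v) ≡ s * s * B u u + 2# * (s * t) * B u v + t * t * B v v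
    B-comb-diagonal s u t v = trans (B-combˡ s u t v _) (trans
      (cong₂ (λ p q → s * p + t * q) (B-combʳ u s u t v) (trans (B-combʳ v s u t v) (cong (λ p → s * p + t * B v v) (B-sym v u))))
      (solve 5 (λ s t p q r → s :* (s :* p :+ t :* q) :+ t :* (s :* q :+ t :* r)
          := s :* s :* p :+ two :* (s :* t) :* q :+ t :* t :* r) refl s t (B u u) (B u v) (B v v)))

    B-comb-orthogonal : ∀ s u t v → B u v ≡ 0# → B (comb s u t v) (comb s u t v) ≡ s * s * B u u + t * t * B v v
    B-comb-orthogonal s u t v h = trans (B-comb-diagonal s u t v) (lincomb₁ (2# * (s * t)) h
      (solve 5 (λ s t p q r → (p :+ two :* (s :* t) :* q :+ r) :- (p :+ r) := two :* (s :* t) :* (q :- nil))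
        refl s t (s * s * B u u) (B u v) (t * t * B v v)))

    det : Carrier
    det = det3 (2# * a C) (d C) (e C) (d C) (2# * b C) (f C) (e C) (f C) (2# * c C)

    adjugate : Vec3 → Vec3
    adjugate v = ⟨ (r * s + - (f C * f C)) * x v + (e C * f C + - (d C * s)) * y v + (d C * f C + - (e C * r)) * z v
                 , (e C * f C + - (d C * s)) * x v + (p * s + - (e C * e C)) * y v + (d C * e C + - (p * f C)) * z v
                 , (d C * f C + - (e C * r)) * x v + (d C * e C + - (p * f C)) * y v + (p * r + - (d C * d C)) * z v ⟩
      where
      p = 2# * a C
      r = 2# * b C
      s = 2# * c C

    M-adjugate : ∀ v → M (adjugate v) ≡ scale det v
    M-adjugate v = vec≡
      (solve 9 (λ p r s d e f x y z →
        p :* X p r s d e f x y z :+ d :* Y p r s d e f x y z :+ e :* Z p r s d e f x y z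
        := D p r s d e f :* x) refl (2# * a C) (2# * b C) (2# * c C) (d C) (e C) (f C) (x v) (y v) (z v))
      (solve 9 (λ p r s d e f x y z →
        d :* X p r s d e f x y z :+ r :* Y p r s d e f x y z :+ f :* Z p r s d e f x y z
        := D p r s d e f :* y) refl (2# * a C) (2# * b C) (2# * c C) (d C) (e C) (f C) (x v) (y v) (z v))
      (solve 9 (λ p r s d e f x y z →
        e :* X p r s d e f x y z :+ f :* Y p r s d e f x y z :+ s :* Z p r s d e f x y z
        := D p r s d e f :* z) refl (2# * a C) (2# * b C) (2# * c C) (d C) (e C) (f C) (x v) (y v) (z v))
      where
      X Y Z : (p r s d e f x y z : Polynomial 9) → Polynomial 9
      X p r s d e f x y z = (r :* s :- f :* f) :* x :+ (e :* f :- d :* s) :* y :+ (d :* f :- e :* r) :* z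
      Y p r s d e f x y z = (e :* f :- d :* s) :* x :+ (p :* s :- e :* e) :* y :+ (d :* e :- p :* f) :* z
      Z p r s d e f x y z = (d :* f :- e :* r) :* x :+ (d :* e :- p :* f) :* y :+ (p :* r :- d :* d) :* z
      D : (p r s d e f : Polynomial 9) → Polynomial 9
      D p r s d e f = p :* (r :* s :- f :* f) :- d :* (d :* s :- f :* e) :+ e :* (d :* f :- r :* e)

    -- An external line, its pole, and tangents.

    module ExternalLine (2≢0 : ¬ 2# ≡ 0#) (irreducible : Irreducible C) (L : Line) (external : External C L) where
      open OddCharacteristic 2≢0

      l : Vec3
      l = lcoords L

      ∈C⇒isotropic : ∀ P → P ∈C C → B (coords P) (coords P) ≡ 0#
      ∈C⇒isotropic P h = trans (B-diagonal (coords P)) (trans (cong (2# *_) h) (zeroʳ 2#))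

      isotropic⇒∈C : ∀ P → B (coords P) (coords P) ≡ 0# → P ∈C C
      isotropic⇒∈C P h = x*y≡0⇒y≡0 2≢0 (trans (sym (B-diagonal (coords P))) h)

      anisotropic : ∀ {v} → NonZero3 v → dot l v ≡ 0# → ¬ B v v ≡ 0#
      anisotropic {v} v≢0 v∈l h = external (pt v v≢0) v∈l (isotropic⇒∈C (pt v v≢0) h)

      isotropic-on-line : ∀ {v} → dot l v ≡ 0# → B v v ≡ 0# → v ≡ 0⃗
      isotropic-on-line {v} v∈l h = [ id , (λ v≢0 → contradiction h (anisotropic v≢0 v∈l)) ]′ (zero-or-nonzero v)

      -- This is det · M⁻¹ l, so pairing with it under B is det times the equation of L.
      pole : Vec3
      pole = adjugate l

      B-pole : ∀ v → B v pole ≡ det * dot l v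
      B-pole v = trans (cong (dot v) (M-adjugate l)) (trans (dot-scale v det l) (cong (det *_) (dot-comm v l)))

      -- On L the pole would be orthogonal to itself and hence the zero vector, yet it pairs
      -- nontrivially with any point off L.
      pole∉L : ¬ dot l pole ≡ 0#
      pole∉L h = contradiction (trans (sym (B-pole u)) (trans (B-sym u pole)
                   (trans (cong (λ w → B w u) pole≡0) (B-zeroˡ u)))) (*-nonzero irreducible (proj₂ off))
        where
        off = point-off-line l (lnonzero L)
        u = proj₁ off
        pole≡0 : pole ≡ 0⃗
        pole≡0 = isotropic-on-line h (trans (B-pole pole) (trans (cong (det *_) h) (zeroʳ det)))

      pole≢0 : NonZero3 pole
      pole≢0 = ≢⇒nonzero λ e → pole∉L (trans (cong (dot l) e) (dot-zeroʳ l))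

      polePoint : Point
      polePoint = pt pole pole≢0

      γ : Carrier
      γ = B pole pole

      γ≢0 : ¬ γ ≡ 0#
      γ≢0 h = *-nonzero irreducible pole∉L (trans (sym (B-pole pole)) h)

      line-⊥-pole : ∀ {v} → dot l v ≡ 0# → B v pole ≡ 0#
      line-⊥-pole {v} h = trans (B-pole v) (trans (cong (det *_) h) (zeroʳ det))

      poleCoord : Vec3 → Carrier
      poleCoord v = dot l v * inv (dot l pole)

      lineComponent : Vec3 → Vec3
      lineComponent v = comb 1# v (- poleCoord v) pole

      lineComponent∈L : ∀ v → dot l (lineComponent v) ≡ 0#
      lineComponent∈L v = trans (dot-comb l 1# v (- poleCoord v) pole)
        (lincomb₁ (- dot l v) (inv-inverseʳ pole∉L)
          (solve 3 (λ a b i → one :* a :+ (:- (a :* i)) :* b :- nil := (:- a) :* (b :* i :- one))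
            refl (dot l v) (dot l pole) (inv (dot l pole))))

      decomposition : ∀ v → v ≡ comb 1# (lineComponent v) (poleCoord v) pole
      decomposition v = vec≡ (eq (x v) (x pole)) (eq (y v) (y pole)) (eq (z v) (z pole))
        where
        eq : ∀ a b → a ≡ 1# * (1# * a + - poleCoord v * b) + poleCoord v * b
        eq a b = solve 3 (λ a b t → a := one :* (one :* a :+ (:- t) :* b) :+ t :* b) refl a b (poleCoord v)

      poleCoord≢0 : ∀ {v} → ¬ dot l v ≡ 0# → ¬ poleCoord v ≡ 0#
      poleCoord≢0 v∉l h = v∉l (x*y≡0⇒y≡0 (inv-nonzero pole∉L) (trans (*-comm _ _) h))

      isotropic⇒∉L : ∀ {v} → NonZero3 v → B v v ≡ 0# → ¬ dot l v ≡ 0#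
      isotropic⇒∉L v≢0 h v∈l = anisotropic v≢0 v∈l h

      B-decomposition : ∀ v → B v v ≡ B (lineComponent v) (lineComponent v) + poleCoord v * poleCoord v * γ
      B-decomposition v = trans (cong (λ w → B w w) (decomposition v))
        (trans (B-comb-orthogonal 1# (lineComponent v) (poleCoord v) pole (line-⊥-pole (lineComponent∈L v)))
          (solve 2 (λ p q → one :* one :* p :+ q := p :+ q) refl _ _))

      -- The combination of u and v lying on L is isotropic, hence zero.
      orthogonal-isotropic-parallel : ∀ {u v} → NonZero3 u → NonZero3 v → B u u ≡ 0# → B v v ≡ 0# → B u v ≡ 0# →
        ∃ λ k → ¬ k ≡ 0# × scale k u ≡ v
      orthogonal-isotropic-parallel {u} {v} u≢0 v≢0 uu vv uv =
        m * inv n , *-nonzero m≢0 (inv-nonzero n≢0) , vec≡ (divide (cong x w≡0)) (divide (cong y w≡0)) (divide (cong z w≡0))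
        where
        n = dot l u
        m = dot l v
        n≢0 : ¬ n ≡ 0#
        n≢0 = isotropic⇒∉L u≢0 uu
        m≢0 : ¬ m ≡ 0#
        m≢0 = isotropic⇒∉L v≢0 vv
        w≡0 : comb m u (- n) v ≡ 0⃗
        w≡0 = isotropic-on-line
          (trans (dot-comb l m u (- n) v) (solve 2 (λ m n → m :* n :+ (:- n) :* m := nil) refl m n))
          (trans (B-comb-orthogonal m u (- n) v uv) (trans (cong₂ (λ p q → m * m * p + - n * - n * q) uu vv)
            (solve 2 (λ p q → p :* nil :+ q :* nil := nil) refl (m * m) (- n * - n))))
        divide : ∀ {a b} → m * a + - n * b ≡ 0# → m * inv n * a ≡ b
        divide {a} {b} h = lincomb₂ (inv n) b h (inv-inverseʳ n≢0)
          (solve 5 (λ m n i a b → m :* i :* a :- b := i :* ((m :* a :+ (:- n) :* b) :- nil) :+ b :* (n :* i :- one))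
            refl m n (inv n) a b)

      -- The polar line `M r` is the tangent at r: another point of the conic on it would be
      -- isotropic and orthogonal to r, hence proportional to r.
      tangent-exterior : ∀ P {r} → ¬ B (coords P) (coords P) ≡ 0# → NonZero3 r → B r r ≡ 0# → B (coords P) r ≡ 0# →
        ExteriorPoint C P
      tangent-exterior P {r} PP≢0 r≢0 rr Pr = PP≢0 ∘ ∈C⇒isotropic P
        , tangentLine
        , (pt r r≢0 , trans (dot-comm (M r) r) rr , isotropic⇒∈C (pt r r≢0) rr
          , λ X X∈ X∈C → orthogonal-isotropic-parallel (nonzero X) r≢0 (∈C⇒isotropic X X∈C) rr
              (trans (dot-comm (coords X) (M r)) X∈))
        , trans (dot-comm (M r) (coords P)) Pr
        where
        tangentLine : Line
        -- `M r` is nonzero because r, being isotropic, lies off L and so pairs nontrivially with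
        -- the pole.
        tangentLine = ln (M r) (≢⇒nonzero λ Mr≡0 → *-nonzero irreducible (isotropic⇒∉L r≢0 rr)
          (trans (sym (B-pole r)) (trans (B-sym r pole) (trans (cong (dot pole) Mr≡0) (dot-zeroʳ pole)))))

      -- Otherwise 2 B(P,r) P - B(P,P) r would be a second point of the conic on the tangent.
      exterior-tangent : ∀ P → ExteriorPoint C P → ∃ λ r → NonZero3 r × B r r ≡ 0# × B (coords P) r ≡ 0#
      exterior-tangent P (P∉C , ℓ , (R , R∈ℓ , R∈C , unique) , P∈ℓ) = r , nonzero R , rr , decidable-stable (B p r ≟ 0#) impossible
        where
        r = coords R
        p = coords P
        rr : B r r ≡ 0#
        rr = ∈C⇒isotropic R R∈C
        impossible : ¬ ¬ B p r ≡ 0#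
        -- If c X = r with c ≠ 0, then c B(X,r) = B(r,r) = 0, although B(X,r) = 2 B(p,r)² is
        -- nonzero.
        impossible pr≢0 = *-nonzero (proj₁ (proj₂ X≈R)) Xr≢0
          (trans (sym (B-scaleˡ (proj₁ X≈R) X r)) (trans (cong (λ w → B w r) (proj₂ (proj₂ X≈R))) rr))
          where
          X : Vec3
          X = comb (2# * B p r) p (- B p p) r
          BXr : B X r ≡ 2# * (B p r * B p r)
          BXr = trans (B-combˡ (2# * B p r) p (- B p p) r r) (trans (cong (λ w → 2# * B p r * B p r + - B p p * w) rr)
            (solve 2 (λ s t → two :* s :* s :+ (:- t) :* nil := two :* (s :* s)) refl (B p r) (B p p)))
          Xr≢0 : ¬ B X r ≡ 0#
          Xr≢0 h = *-nonzero 2≢0 (*-nonzero pr≢0 pr≢0) (trans (sym BXr) h)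
          X≢0 : NonZero3 X
          X≢0 = B≢0⇒nonzero r Xr≢0
          XX : B X X ≡ 0#
          XX = trans (B-comb-diagonal (2# * B p r) p (- B p p) r) (trans
            (cong (λ w → 2# * B p r * (2# * B p r) * B p p + 2# * (2# * B p r * - B p p) * B p r + - B p p * - B p p * w) rr)
            (solve 2 (λ s t → two :* s :* (two :* s) :* t :+ two :* (two :* s :* (:- t)) :* s :+ (:- t) :* (:- t) :* nil := nil)
              refl (B p r) (B p p)))
          X≈R : pt X X≢0 ≈P R
          X≈R = unique (pt X X≢0)
            (trans (dot-comb (lcoords ℓ) (2# * B p r) p (- B p p) r) (trans
              (cong₂ (λ s t → 2# * B p r * s + - B p p * t) P∈ℓ R∈ℓ)
              (solve 2 (λ s t → s :* nil :+ t :* nil := nil) refl (2# * B p r) (- B p p))))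
            (isotropic⇒∈C (pt X X≢0) XX)

      parallel⇒≈P : ∀ P Q → cross (coords P) (coords Q) ≡ 0⃗ → P ≈P Q
      parallel⇒≈P P Q h =
        let k , e = parallel (coords P) (coords Q) (nonzero P) h
        in k , (λ k≡0 → nonzero⇒≢ (nonzero Q) (trans e (scale-zero (coords P) k≡0))) , sym e

      ≈P⇒∈ : ∀ P Q n → P ≈P Q → dot n (coords P) ≡ 0# → dot n (coords Q) ≡ 0#
      ≈P⇒∈ P Q n (k , _ , e) h = trans (cong (dot n) (sym e)) (trans (dot-scale n k (coords P)) (trans (cong (k *_) h) (zeroʳ k)))

      -- Both coordinate vectors are multiples of P₁ × P₂, so ℓ is L itself.
      two-points-on-L : ∀ ℓ P₁ P₂ → ¬ P₁ ≈P P₂ → P₁ ∈L L → P₂ ∈L L → P₁ ∈L ℓ → P₂ ∈L ℓ → External C ℓ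
      two-points-on-L ℓ P₁ P₂ P₁≉P₂ P₁∈L P₂∈L P₁∈ℓ P₂∈ℓ X X∈ℓ = external X
        (trans (cong (λ w → dot w X′) l≡) (trans (dot-scaleˡ k′ c⃗ X′) (trans (cong (k′ *_) cX≡0) (zeroʳ k′))))
        where
        X′ = coords X
        c⃗ = cross (coords P₁) (coords P₂)
        c≢0 : NonZero3 c⃗
        c≢0 = ≢⇒nonzero (P₁≉P₂ ∘ parallel⇒≈P P₁ P₂)
        k-n = normals-parallel {n = lcoords ℓ} c≢0 P₁∈ℓ P₂∈ℓ
        k-l = normals-parallel {n = l} c≢0 P₁∈L P₂∈L
        k′ = proj₁ k-l
        l≡ : l ≡ scale k′ c⃗
        l≡ = proj₂ k-l
        cX≡0 : dot c⃗ X′ ≡ 0#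
        cX≡0 = x*y≡0⇒y≡0 (λ k≡0 → nonzero⇒≢ (lnonzero ℓ) (trans (proj₂ k-n) (scale-zero c⃗ k≡0)))
          (trans (sym (dot-scaleˡ (proj₁ k-n) c⃗ X′)) (trans (cong (λ w → dot w X′) (sym (proj₂ k-n))) X∈ℓ))

      -- If p and v were independent, ℓ and L would both be the line p × v, which would put the pole
      -- on L.
      line-through-pole : ∀ ℓ {p v} → NonZero3 p → dot l p ≡ 0# → dot l v ≡ 0# → dot (lcoords ℓ) pole ≡ 0# →
        dot (lcoords ℓ) p ≡ 0# → dot (lcoords ℓ) v ≡ 0# → ∃ λ k → v ≡ scale k p
      line-through-pole ℓ {p} {v} p≢0 lp lv nq np nv = parallel p v p≢0
        ([ id , (λ c≢0 → contradiction c≢0 impossible) ]′ (zero-or-nonzero c⃗))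
        where
        c⃗ = cross p v
        impossible : ¬ NonZero3 c⃗
        impossible c≢0 = nonzero⇒≢ (lnonzero ℓ) (trans n≡ (scale-zero c⃗ k≡0))
          where
          k-n = normals-parallel {n = lcoords ℓ} c≢0 np nv
          k-l = normals-parallel {n = l} c≢0 lp lv
          k = proj₁ k-n
          n≡ : lcoords ℓ ≡ scale k c⃗
          n≡ = proj₂ k-n
          cq≢0 : ¬ dot c⃗ pole ≡ 0#
          cq≢0 h = pole∉L (trans (cong (λ w → dot w pole) (proj₂ k-l))
            (trans (dot-scaleˡ (proj₁ k-l) c⃗ pole) (trans (cong (proj₁ k-l *_) h) (zeroʳ _))))
          k≡0 : k ≡ 0#
          k≡0 = x*y≡0⇒y≡0 cq≢0 (trans (*-comm _ k) (trans (sym (dot-scaleˡ k c⃗ pole)) (trans (cong (λ w → dot w pole) (sym n≡)) nq)))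

      -- Sufficiency: with a square root of -1 the pole extends the exterior points.

      module SquareRootOf-1 (i : Carrier) (i² : i * i ≡ - 1#) where

        i≢0 : ¬ i ≡ 0#
        i≢0 i≡0 = -‿nonzero 1≢0 (trans (sym i²) (trans (cong (_* i) i≡0) (zeroˡ i)))

        -- A point k P + b·pole of the conic and the contact point w + t·pole of a tangent through P would give
        -- the isotropic vector i t k P + b w on L.
        exterior-pole-line : ∀ ℓ P → ExtOn C L P → P ∈L ℓ → dot (lcoords ℓ) pole ≡ 0# → External C ℓ
        exterior-pole-line ℓ P (P-ext , P∈L) P∈ℓ pole∈ℓ X X∈ℓ X∈C = contradiction Y≡0 (nonzero⇒≢ Y≢0)
          where
          n = lcoords ℓ
          p = coords P
          X′ = coords X
          b′ = poleCoord X′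
          XX : B X′ X′ ≡ 0#
          XX = ∈C⇒isotropic X X∈C
          nW : dot n (lineComponent X′) ≡ 0#
          nW = trans (dot-comb n 1# X′ (- b′) pole) (trans (cong₂ (λ s t → 1# * s + - b′ * t) X∈ℓ pole∈ℓ)
            (solve 1 (λ b → one :* nil :+ (:- b) :* nil := nil) refl b′))
          W = line-through-pole ℓ (nonzero P) P∈L (lineComponent∈L X′) pole∈ℓ P∈ℓ nW
          k = proj₁ W
          pp = B p p
          kkpp : k * k * pp + b′ * b′ * γ ≡ 0#
          kkpp = trans (cong (_+ b′ * b′ * γ) (sym (trans (cong (λ w → B w w) (proj₂ W))
            (trans (B-scaleˡ k p (scale k p)) (trans (cong (k *_) (trans (B-sym p (scale k p)) (B-scaleˡ k p p)))
              (sym (*-assoc k k pp))))))) (trans (sym (B-decomposition X′)) XX)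
          contact = exterior-tangent P P-ext
          r = proj₁ contact
          r≢0 = proj₁ (proj₂ contact)
          rr : B r r ≡ 0#
          rr = proj₁ (proj₂ (proj₂ contact))
          pr : B p r ≡ 0#
          pr = proj₂ (proj₂ (proj₂ contact))
          t = poleCoord r
          w = lineComponent r
          ww : B w w + t * t * γ ≡ 0#
          ww = trans (sym (B-decomposition r)) rr
          pw : B p w ≡ 0#
          pw = trans (B-combʳ p 1# r (- t) pole) (trans (cong₂ (λ u v → 1# * u + - t * v) pr (line-⊥-pole P∈L))
            (solve 1 (λ t → one :* nil :+ (:- t) :* nil := nil) refl t))
          b≢0 : ¬ b′ ≡ 0#
          b≢0 = poleCoord≢0 (isotropic⇒∉L (nonzero X) XX)
          t≢0 : ¬ t ≡ 0#
          t≢0 = poleCoord≢0 (isotropic⇒∉L r≢0 rr)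
          k≢0 : ¬ k ≡ 0#
          k≢0 k≡0 = *-nonzero (*-nonzero b≢0 b≢0) γ≢0 (trans
            (solve 2 (λ s u → u := nil :* nil :* s :+ u) refl pp (b′ * b′ * γ))
            (trans (cong (λ k → k * k * pp + b′ * b′ * γ) (sym k≡0)) kkpp))
          -- The two isotropy relations give (t k)² B(p,p) = - (b t)² γ = b² B(w,w). Since p and w
          -- are orthogonal, the factor i makes these terms cancel in B(Y,Y).
          s = i * t * k
          Y = comb s p b′ w
          Y≡0 : Y ≡ 0⃗
          Y≡0 = isotropic-on-line
            (trans (dot-comb l s p b′ w) (trans (cong₂ (λ u v → s * u + b′ * v) P∈L (lineComponent∈L r))
              (solve 2 (λ s b → s :* nil :+ b :* nil := nil) refl s b′)))
            (trans (B-comb-orthogonal s p b′ w pw) (lincomb₃ (t * t * k * k * pp) (- (t * t)) (b′ * b′) i² kkpp ww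
              (solve 7 (λ i t k p b w g →
                 (i :* t :* k :* (i :* t :* k) :* p :+ b :* b :* w) :- nil
                 := t :* t :* k :* k :* p :* (i :* i :- :- one) :+ (:- (t :* t)) :* ((k :* k :* p :+ b :* b :* g) :- nil)
                    :+ b :* b :* ((w :+ t :* t :* g) :- nil))
                refl i t k pp b′ (B w w) γ)))
          Y≢0 : NonZero3 Y
          -- Because w is orthogonal to p, B(Y,p) is s B(p,p), a product of nonzero factors.
          Y≢0 = B≢0⇒nonzero p λ h → *-nonzero (*-nonzero (*-nonzero i≢0 t≢0) k≢0) (anisotropic (nonzero P) P∈L)
            (trans (sym (trans (B-combˡ s p b′ w p) (trans (cong (λ v → s * pp + b′ * v) (trans (B-sym w p) pw))
              (solve 2 (λ u b → u :+ b :* nil := u) refl (s * pp) b′)))) h)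

        pole-exterior-set : ExteriorSet C (ExtOn C L ∪｛ polePoint ｝)
        pole-exterior-set ℓ P₁ P₂ (inj₁ (_ , P₁∈L)) (inj₁ (_ , P₂∈L)) P₁≉P₂ P₁∈ℓ P₂∈ℓ =
          two-points-on-L ℓ P₁ P₂ P₁≉P₂ P₁∈L P₂∈L P₁∈ℓ P₂∈ℓ
        pole-exterior-set ℓ P₁ P₂ (inj₁ P₁∈S) (inj₂ P₂≈) _ P₁∈ℓ P₂∈ℓ =
          exterior-pole-line ℓ P₁ P₁∈S P₁∈ℓ (≈P⇒∈ P₂ polePoint (lcoords ℓ) P₂≈ P₂∈ℓ)
        pole-exterior-set ℓ P₁ P₂ (inj₂ P₁≈) (inj₁ P₂∈S) _ P₁∈ℓ P₂∈ℓ =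
          exterior-pole-line ℓ P₂ P₂∈S P₂∈ℓ (≈P⇒∈ P₁ polePoint (lcoords ℓ) P₁≈ P₁∈ℓ)
        pole-exterior-set ℓ P₁ P₂ (inj₂ (k₁ , k₁≢0 , e₁)) (inj₂ (k₂ , k₂≢0 , e₂)) P₁≉P₂ _ _ =
          contradiction (parallel⇒≈P P₁ P₂ parallel₁₂) P₁≉P₂
          where
          p₁ = coords P₁
          p₂ = coords P₂
          entry : ∀ {a b c d} → k₁ * a ≡ k₂ * c → k₁ * b ≡ k₂ * d → a * d + - (b * c) ≡ 0#
          entry {a} {b} {c} {d} h h′ = x*y≡0⇒y≡0 k₁≢0 (lincomb₂ d (- c) h h′
            (solve 6 (λ k m a b c d → k :* (a :* d :- b :* c) :- nil
               := d :* (k :* a :- m :* c) :+ (:- c) :* (k :* b :- m :* d)) refl k₁ k₂ a b c d))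
          e₁₂ = trans e₁ (sym e₂)
          parallel₁₂ : cross p₁ p₂ ≡ 0⃗
          parallel₁₂ = vec≡ (entry (cong y e₁₂) (cong z e₁₂)) (entry (cong z e₁₂) (cong x e₁₂)) (entry (cong x e₁₂) (cong y e₁₂))

      -- Necessity: an admissible point off the line is the pole.

      module OffLine (Q : Point) (Q∉L : ¬ Q ∈L L) (exterior : ExteriorSet C (ExtOn C L ∪｛ Q ｝)) where

        h : Carrier
        h = γ * poleCoord (coords Q)

        h≢0 : ¬ h ≡ 0#
        h≢0 = *-nonzero γ≢0 (poleCoord≢0 Q∉L)

        -- Used twice: with m = 1 and e₁ the component of Q on L, to refute that this component is
        -- nonzero; then with m = 0 and e₁ any point of L, once Q is known to be the pole.
        module Basis {e₁} (e₁≢0 : NonZero3 e₁) (e₁∈L : dot l e₁ ≡ 0#) (m : Carrier)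
          (Q≡ : coords Q ≡ comb m e₁ (poleCoord (coords Q)) pole) where

          t : Carrier
          t = poleCoord (coords Q)

          e₂ : Vec3
          e₂ = cross l (M e₁)

          e₂∈L : dot l e₂ ≡ 0#
          e₂∈L = dot-crossˡ l (M e₁)

          e₁⊥e₂ : B e₁ e₂ ≡ 0#
          e₁⊥e₂ = trans (B-sym e₁ e₂) (trans (dot-comm e₂ (M e₁)) (dot-crossʳ l (M e₁)))

          e₂≢0 : NonZero3 e₂
          e₂≢0 = ≢⇒nonzero λ e₂≡0 →
            -- If `M e₁` were a multiple of l, then e₁, lying on L, would be isotropic.
            let k , e = parallel l (M e₁) (lnonzero L) e₂≡0
            in anisotropic e₁≢0 e₁∈L (trans (cong (dot e₁) e) (trans (dot-scale e₁ k l)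
                 (trans (cong (k *_) (trans (dot-comm e₁ l) e₁∈L)) (zeroʳ k))))

          α β κ : Carrier
          α = B e₁ e₁
          β = B e₂ e₂
          κ = - (γ * (α * β))

          α≢0 : ¬ α ≡ 0#
          α≢0 = anisotropic e₁≢0 e₁∈L

          β≢0 : ¬ β ≡ 0#
          β≢0 = anisotropic e₂≢0 e₂∈L

          κ≢0 : ¬ κ ≡ 0#
          κ≢0 = -‿nonzero (*-nonzero γ≢0 (*-nonzero α≢0 β≢0))

          comb∈L : ∀ X Y → dot l (comb X e₁ Y e₂) ≡ 0#
          comb∈L X Y = trans (dot-comb l X e₁ Y e₂) (trans (cong₂ (λ u v → X * u + Y * v) e₁∈L e₂∈L)
            (solve 2 (λ s b → s :* nil :+ b :* nil := nil) refl X Y))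

          -- For r² = - α β the vector r e₁ + α e₂ on L is isotropic, hence zero, but its product
          -- with e₂ is α β.
          -αβ-nonsquare : ¬ IsSquare (- (α * β))
          -αβ-nonsquare (r , r²) = *-nonzero α≢0 β≢0 (trans (sym Be₂) (trans (cong (λ v → B v e₂) v≡0) (B-zeroˡ e₂)))
            where
            v≡0 : comb r e₁ α e₂ ≡ 0⃗
            v≡0 = isotropic-on-line (comb∈L r α) (trans (B-comb-orthogonal r e₁ α e₂ e₁⊥e₂)
              (lincomb₁ α r² (solve 3 (λ r a b → (r :* r :* a :+ a :* a :* b) :- nil := a :* (r :* r :- :- (a :* b))) refl r α β)))
            Be₂ : B (comb r e₁ α e₂) e₂ ≡ α * β
            Be₂ = trans (B-combˡ r e₁ α e₂ e₂) (trans (cong (λ v → r * v + α * β) e₁⊥e₂)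
              (solve 2 (λ r u → r :* nil :+ u := u) refl r (α * β)))

          -- The line joining Q to u = X e₁ + Y e₂ misses the conic, so the discriminant
          -- B(u,Q)² - B(u,u) B(Q,Q) = - α β ((m Y)² - h²) is a nonsquare.
          difference-of-squares : ∀ X Y → α * (X * X) + β * (Y * Y) ≡ κ →
            ∃ λ w → ¬ w ≡ 0# × w * w ≡ m * Y * (m * Y) + - (h * h)
          difference-of-squares X Y on =
            let w , w≢0 , e = nonsquares-proportional -αβ-nonsquare discriminant-nonsquare
            in w , w≢0 , *-cancelˡ (nonsquare⇒≢0 -αβ-nonsquare) (trans e discriminant≡)
            where
            u u⊥ r : Vec3
            u  = comb X e₁ Y e₂
            -- u⊥ spans the orthogonal complement of u within L, and r is the contact point that
            -- makes u exterior.
            u⊥ = comb (- (β * Y)) e₁ (α * X) e₂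
            r  = comb 1# u⊥ (α * β) pole
            uu : B u u ≡ κ
            uu = trans (B-comb-orthogonal X e₁ Y e₂ e₁⊥e₂) (trans
              (solve 4 (λ x y a b → x :* x :* a :+ y :* y :* b := a :* (x :* x) :+ b :* (y :* y)) refl X Y α β) on)
            u∈L = comb∈L X Y
            u⊥∈L = comb∈L (- (β * Y)) (α * X)
            u≢0 : NonZero3 u
            u≢0 = B≢0⇒nonzero u λ e → κ≢0 (trans (sym uu) e)
            Be₁ : ∀ s s′ → B (comb s e₁ s′ e₂) e₁ ≡ s * α
            Be₁ s s′ = trans (B-combˡ s e₁ s′ e₂ e₁) (trans (cong (λ v → s * α + s′ * v) (trans (B-sym e₂ e₁) e₁⊥e₂))
              (solve 2 (λ p q → p :+ q :* nil := p) refl (s * α) s′))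
            Be₂ : ∀ s s′ → B (comb s e₁ s′ e₂) e₂ ≡ s′ * β
            Be₂ s s′ = trans (B-combˡ s e₁ s′ e₂ e₂) (trans (cong (λ v → s * v + s′ * β) e₁⊥e₂)
              (solve 2 (λ p q → q :* nil :+ p := p) refl (s′ * β) s))
            uu⊥ : B u u⊥ ≡ 0#
            uu⊥ = trans (B-combʳ u (- (β * Y)) e₁ (α * X) e₂) (trans
              (cong₂ (λ p q → - (β * Y) * p + α * X * q) (Be₁ X Y) (Be₂ X Y))
              (solve 4 (λ x y a b → (:- (b :* y)) :* (x :* a) :+ a :* x :* (y :* b) := nil) refl X Y α β))
            ur : B u r ≡ 0#
            ur = trans (B-combʳ u 1# u⊥ (α * β) pole) (trans
              (cong₂ (λ p q → 1# * p + α * β * q) uu⊥ (line-⊥-pole u∈L))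
              (solve 1 (λ p → one :* nil :+ p :* nil := nil) refl (α * β)))
            rr : B r r ≡ 0#
            rr = trans (B-comb-orthogonal 1# u⊥ (α * β) pole (line-⊥-pole u⊥∈L)) (trans
              (cong (λ p → 1# * 1# * p + α * β * (α * β) * γ) (B-comb-orthogonal (- (β * Y)) e₁ (α * X) e₂ e₁⊥e₂))
              (lincomb₁ (α * β) on (solve 5 (λ x y a b g →
                  (one :* one :* ((:- (b :* y)) :* (:- (b :* y)) :* a :+ a :* x :* (a :* x) :* b) :+ a :* b :* (a :* b) :* g) :- nil
                  := a :* b :* ((a :* (x :* x) :+ b :* (y :* y)) :- (:- (g :* (a :* b))))) refl X Y α β γ)))
            r≢0 : NonZero3 r
            r≢0 = ≢⇒nonzero λ r≡0 → *-nonzero (*-nonzero α≢0 β≢0) pole∉L (trans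
              (sym (trans (dot-comb l 1# u⊥ (α * β) pole) (trans (cong (λ p → 1# * p + α * β * dot l pole) u⊥∈L)
                (solve 1 (λ p → one :* nil :+ p := p) refl (α * β * dot l pole)))))
              (trans (cong (dot l) r≡0) (dot-zeroʳ l)))
            U : Point
            U = pt u u≢0
            Q′ = coords Q
            U∈S : ExtOn C L U
            U∈S = tangent-exterior U (λ e → κ≢0 (trans (sym uu) e)) r≢0 rr ur , u∈L
            U≉Q : ¬ U ≈P Q
            U≉Q U≈Q = Q∉L (≈P⇒∈ U Q l U≈Q u∈L)
            n = cross u Q′
            joinLine : Line
            joinLine = ln n (≢⇒nonzero (U≉Q ∘ parallel⇒≈P U Q))
            U∈join : dot n u ≡ 0#
            U∈join = trans (dot-comm n u) (dot-crossˡ u Q′)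
            Q∈join : dot n Q′ ≡ 0#
            Q∈join = trans (dot-comm n Q′) (dot-crossʳ u Q′)
            join-external : External C joinLine
            join-external = exterior joinLine U Q (inj₁ U∈S)
              (inj₂ (1# , 1≢0 , vec≡ (*-identityˡ _) (*-identityˡ _) (*-identityˡ _))) U≉Q U∈join Q∈join
            no-root : ∀ s → ¬ s * s * B u u + 2# * (s * 1#) * B u Q′ + 1# * 1# * B Q′ Q′ ≡ 0#
            no-root s e = join-external (pt v v≢0)
              (trans (dot-comb n s u 1# Q′) (trans (cong₂ (λ p q → s * p + 1# * q) U∈join Q∈join)
                (solve 1 (λ s → s :* nil :+ one :* nil := nil) refl s)))
              (isotropic⇒∈C (pt v v≢0) (trans (B-comb-diagonal s u 1# Q′) e))
              where
              v = comb s u 1# Q′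
              v≢0 : NonZero3 v
              v≢0 = ≢⇒nonzero λ v≡0 → Q∉L (trans
                (sym (trans (dot-comb l s u 1# Q′) (trans (cong (λ p → s * p + 1# * dot l Q′) u∈L)
                  (solve 2 (λ s p → s :* nil :+ one :* p := p) refl s (dot l Q′)))))
                (trans (cong (dot l) v≡0) (dot-zeroʳ l)))
            discriminant : Carrier
            discriminant = B u Q′ * B u Q′ + - (κ * B Q′ Q′)
            discriminant-nonsquare : ¬ IsSquare discriminant
            discriminant-nonsquare (ρ , ρ²) = no-root s (x*y≡0⇒y≡0 κ≢0 (lincomb₃
                (κ * s * s) ((ρ + - B u Q′) * (ρ + - B u Q′) * (κ * inv κ + 1#) + 2# * (ρ + - B u Q′) * B u Q′) 1#
                uu (inv-inverseʳ κ≢0) ρ²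
                (solve 6 (λ k k′ ρ u b q →
                    k :* ((ρ :- b) :* k′ :* ((ρ :- b) :* k′) :* u :+ two :* ((ρ :- b) :* k′ :* one) :* b :+ one :* one :* q) :- nil
                    := k :* ((ρ :- b) :* k′) :* ((ρ :- b) :* k′) :* (u :- k)
                       :+ ((ρ :- b) :* (ρ :- b) :* (k :* k′ :+ one) :+ two :* (ρ :- b) :* b) :* (k :* k′ :- one)
                       :+ one :* (ρ :* ρ :- (b :* b :- k :* q)))
                  refl κ (inv κ) ρ (B u u) (B u Q′) (B Q′ Q′))))
              where
              -- The quadratic formula for κ s² + 2 B(u,Q) s + B(Q,Q) = 0, whose quarter
              -- discriminant is ρ².
              s = (ρ + - B u Q′) * inv κ
            BuQ : B u Q′ ≡ m * (X * α)
            BuQ = trans (cong (B u) Q≡) (trans (B-combʳ u m e₁ t pole) (trans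
              (cong₂ (λ p q → m * p + t * q) (Be₁ X Y) (line-⊥-pole u∈L))
              (solve 2 (λ p t → p :+ t :* nil := p) refl (m * (X * α)) t)))
            BQQ : B Q′ Q′ ≡ m * m * α + t * t * γ
            BQQ = trans (cong (λ v → B v v) Q≡) (B-comb-orthogonal m e₁ t pole (line-⊥-pole e₁∈L))
            discriminant≡ : discriminant ≡ - (α * β) * (m * Y * (m * Y) + - (h * h))
            -- On the ellipse α X² - κ = - β Y², which eliminates X.
            discriminant≡ = trans (cong₂ (λ p q → p * p + - (κ * q)) BuQ BQQ) (lincomb₁ (m * m * α) on
              (solve 7 (λ x y a b g m t →
                  (m :* (x :* a) :* (m :* (x :* a)) :- (:- (g :* (a :* b))) :* (m :* m :* a :+ t :* t :* g))
                  :- (:- (a :* b)) :* (m :* y :* (m :* y) :- g :* t :* (g :* t))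
                  := m :* m :* a :* ((a :* (x :* x) :+ b :* (y :* y)) :- (:- (g :* (a :* b)))))
                refl X Y α β γ m t))

        lineComponent≡0 : lineComponent (coords Q) ≡ 0⃗
        lineComponent≡0 = [ id , (λ V≢0 → contradiction V≢0 impossible) ]′ (zero-or-nonzero (lineComponent (coords Q)))
          where
          impossible : ¬ NonZero3 (lineComponent (coords Q))
          impossible V≢0 =
            let x₀ , y₀ , on₀ = diagonal-form-universal α≢0 β≢0 κ
            in Ellipse.y²-h²-not-always-square -αβ-nonsquare κ≢0 x₀ y₀ on₀ h≢0 λ X Y on →
                 let w , w≢0 , e = difference-of-squares X Y on
                 in w , w≢0 , trans e (solve 2 (λ y h → one :* y :* (one :* y) :- h := y :* y :- h) refl Y (h * h))
            where open Basis V≢0 (lineComponent∈L (coords Q)) 1# (decomposition (coords Q))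

        Q≡pole : coords Q ≡ scale (poleCoord (coords Q)) pole
        Q≡pole = trans (decomposition (coords Q)) (trans
          (cong (λ v → comb 1# v (poleCoord (coords Q)) pole) lineComponent≡0) (comb-zeroˡ 1# _ pole))

        Q≈pole : Q ≈P polePoint
        Q≈pole = inv t , inv-nonzero t≢0 , trans (cong (scale (inv t)) Q≡pole) (scale-inv pole t≢0)
          where
          t = poleCoord (coords Q)
          t≢0 : ¬ t ≡ 0#
          t≢0 = poleCoord≢0 Q∉L

        -- With m = 0 the nonzero square w² equals - h² whatever the point of the ellipse, so w / h
        -- squares to -1.
        -1-square : IsSquare (- 1#)
        -1-square =
          let x₀ , y₀ , on₀ = diagonal-form-universal α≢0 β≢0 κ
              w , _ , e = difference-of-squares x₀ y₀ on₀
          in w * inv h , lincomb₂ (inv h * inv h) (- (h * inv h + 1#)) e (inv-inverseʳ h≢0)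
               (solve 4 (λ w i h y → w :* i :* (w :* i) :- :- one
                  := i :* i :* (w :* w :- (nil :* y :* (nil :* y) :- h :* h)) :+ (:- (h :* i :+ one)) :* (h :* i :- one))
                 refl w (inv h) h y₀)
          where
          some = line-has-point l (lnonzero L)
          pad : ∀ a b → a ≡ 0# * b + a
          pad = solve 2 (λ a b → a := nil :* b :+ a) refl
          open Basis (proj₁ (proj₂ some)) (proj₂ (proj₂ some)) 0# (trans Q≡pole (vec≡ (pad _ _) (pad _ _) (pad _ _)))

theorem3p1 : (q : ℕ) (F : FiniteField q) → q % 2 ≡ 1 →
    let open Geometry F in
    (C : Conic) → Irreducible C → (L : Line) → External C L →
    (q % 4 ≡ 3 → ∀ (Q : Point) → ExteriorSet C (ExtOn C L ∪｛ Q ｝) → Q ∈L L)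
    × (q % 4 ≡ 1 → Σ Point λ Q → ¬ (Q ∈L L) × ExteriorSet C (ExtOn C L ∪｛ Q ｝)
    × (∀ (Q′ : Point) → ¬ (Q′ ∈L L) → ExteriorSet C (ExtOn C L ∪｛ Q′ ｝) → Q′ ≈P Q))
theorem3p1 q F odd C irreducible L external = q≡3 , q≡1
  where
  open FiniteField F
  open Geometry F
  open FieldTheory F
  open OddCharacteristic (odd-order⇒2≢0 odd)
  open ProjectivePlane F
  open PolarForm C
  open ExternalLine (odd-order⇒2≢0 odd) irreducible L external

  q≡3 : q % 4 ≡ 3 → ∀ (Q : Point) → ExteriorSet C (ExtOn C L ∪｛ Q ｝) → Q ∈L L
  q≡3 q%4≡3 Q exterior = decidable-stable (dot l (coords Q) ≟ 0#) λ Q∉L →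
    contradiction (trans (sym q%4≡3) (-1-square⇒order (OffLine.-1-square Q Q∉L exterior))) λ ()

  q≡1 : q % 4 ≡ 1 → Σ Point λ Q → ¬ (Q ∈L L) × ExteriorSet C (ExtOn C L ∪｛ Q ｝)
    × (∀ (Q′ : Point) → ¬ (Q′ ∈L L) → ExteriorSet C (ExtOn C L ∪｛ Q′ ｝) → Q′ ≈P Q)
  q≡1 q%4≡1 =
    let i , i² = decidable-stable (isSquare? (- 1#)) λ no-i →
                   contradiction (trans (sym q%4≡1) (-1-nonsquare⇒order no-i)) λ ()
    in polePoint , pole∉L , SquareRootOf-1.pole-exterior-set i i² , OffLine.Q≈pole
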